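{- Let $r_1,r_2\ge 2$ and $t_1,t_2\ge 3$. For $i=1,2$, let $G_i$ be an $r_i$-regular graph of order $p_i$ that admits a local antimagic $t_i$-coloring $f_i$, with $G_1,G_2$ vertex-disjoint and $r_1+p_2=r_2+p_1=r$, so that $G=G_1\vee G_2$ is $r$-regular. Suppose $p_1\equiv p_2\pmod 2$ and that for all $u\in V(G_1)$ and $v\in V(G_2)$, $$f_2^+(v)-f_1^+(u)\ne \frac{(p_2-p_1)(p_1p_2+1)}{2}+(r_1-r_2)p_1p_2-\frac{p_1r_1r_2}{2}.$$ Then $\chi_{la}(G)\le t_1+t_2$, with equality if $\chi(G_i)=t_i$ for $i=1,2$.
   Context: For a simple graph with $q$ edges, a bijection $f:E\to\{1,\dots,q\}$ is a local antimagic labeling if $f^+(u)\neq f^+(v)$ for every edge $uv$, where $f^+(u)=\sum_{e\ni u} f(e)$; if $f^+$ takes exactly $t$ distinct values, $f$ is a local antimagic $t$-coloring. $\chi_{la}$ is the minimum number of distinct values of $f^+$ over all local antimagic labelings; $\chi$ is the chromatic number. The join $G_1\vee G_2$ of vertex-disjoint graphs has vertex set $V(G_1)\cup V(G_2)$ and edge set $E(G_1)\cup E(G_2)\cup\{uv:u\in V(G_1),v\in V(G_2)\}$. -}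

module Defs where

open import Data.Bool using (Bool; true; false; T; if_then_else_; _∧_)
open import Data.Nat using (ℕ; zero; suc; _+_; _<_; _≤_; _<ᵇ_)
import Data.Nat.Properties as ℕP
open import Data.Fin using (Fin; toℕ; splitAt; _≟_)
open import Data.Fin.Permutation using (Permutation′; _⟨$⟩ʳ_)
open import Data.List using (List; []; _∷_; [_]; length; lookup; allFin; concatMap; map; deduplicate)
open import Data.Nat.ListAction using (sum)
open import Data.Product using (_×_; _,_; proj₁; proj₂; ∃; ∃-syntax)
open import Data.Sum using (_⊎_; inj₁; inj₂)
open import Relation.Nullary using (¬_)
open import Relation.Binary.PropositionalEquality using (_≡_; _≢_; refl)

record Graph : Set where
  field
    n      : ℕ
    adj    : Fin n → Fin n → Bool
    sym    : ∀ i j → adj i j ≡ adj j i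
    irrefl : ∀ i → adj i i ≡ false
open Graph public

order : Graph → ℕ
order G = n G

degree : (G : Graph) → Fin (n G) → ℕ
degree G u = sum (map (λ v → if adj G u v then 1 else 0) (allFin (n G)))

Regular : Graph → ℕ → Set
Regular G r = ∀ u → degree G u ≡ r

edges : (G : Graph) → List (Fin (n G) × Fin (n G))
edges G = concatMap (λ i → concatMap (λ j →
            if (toℕ i <ᵇ toℕ j) ∧ adj G i j then [ (i , j) ] else [])
          (allFin (n G))) (allFin (n G))

size : Graph → ℕ
size G = length (edges G)

edge : (G : Graph) → Fin (size G) → Fin (n G) × Fin (n G)
edge G = lookup (edges G)

-- An edge labeling f : E → {1,…,q} that is a bijection: a permutation σ of
-- the edge indices; the edge with index k gets label 1 + σ(k).
Labeling : Graph → Set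
Labeling G = Permutation′ (size G)

label : (G : Graph) → Labeling G → Fin (size G) → ℕ
label G σ k = suc (toℕ (σ ⟨$⟩ʳ k))

incident : {m : ℕ} → Fin m → Fin m × Fin m → Bool
incident u (i , j) with u ≟ i | u ≟ j
... | Relation.Nullary.yes _ | _ = true
... | Relation.Nullary.no _  | Relation.Nullary.yes _ = true
... | Relation.Nullary.no _  | Relation.Nullary.no _ = false

fplus : (G : Graph) → Labeling G → Fin (n G) → ℕ
fplus G σ u = sum (map (λ k → if incident u (edge G k) then label G σ k else 0)
                       (allFin (size G)))

IsLocalAntimagic : (G : Graph) → Labeling G → Set
IsLocalAntimagic G σ = ∀ u v → T (adj G u v) → fplus G σ u ≢ fplus G σ v

numColors : (G : Graph) → Labeling G → ℕ
numColors G σ = length (deduplicate Data.Nat._≟_ (map (fplus G σ) (allFin (n G))))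

IsLocalAntimagicColoring : (G : Graph) → Labeling G → ℕ → Set
IsLocalAntimagicColoring G σ t = IsLocalAntimagic G σ × numColors G σ ≡ t

ChiLaAtMost : Graph → ℕ → Set
ChiLaAtMost G k = ∃[ σ ] (IsLocalAntimagic G σ × numColors G σ ≤ k)

ChiLaAtLeast : Graph → ℕ → Set
ChiLaAtLeast G k = ∀ σ → IsLocalAntimagic G σ → k ≤ numColors G σ

ChiLaEq : Graph → ℕ → Set
ChiLaEq G k = ChiLaAtMost G k × ChiLaAtLeast G k

ProperColoring : (G : Graph) → (k : ℕ) → (Fin (n G) → Fin k) → Set
ProperColoring G k c = ∀ u v → T (adj G u v) → c u ≢ c v

Colorable : Graph → ℕ → Set
Colorable G k = ∃[ c ] ProperColoring G k c

IsChromaticNumber : Graph → ℕ → Set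
IsChromaticNumber G t = Colorable G t × (∀ k → k < t → ¬ Colorable G k)

joinAdj′ : {p₁ p₂ : ℕ} → (Fin p₁ → Fin p₁ → Bool) → (Fin p₂ → Fin p₂ → Bool)
         → Fin p₁ ⊎ Fin p₂ → Fin p₁ ⊎ Fin p₂ → Bool
joinAdj′ a₁ a₂ (inj₁ x) (inj₁ y) = a₁ x y
joinAdj′ a₁ a₂ (inj₂ x) (inj₂ y) = a₂ x y
joinAdj′ a₁ a₂ (inj₁ x) (inj₂ y) = true
joinAdj′ a₁ a₂ (inj₂ x) (inj₁ y) = true

private
  joinSym′ : (G₁ G₂ : Graph) → ∀ x y →
    joinAdj′ (adj G₁) (adj G₂) x y ≡ joinAdj′ (adj G₁) (adj G₂) y x
  joinSym′ G₁ G₂ (inj₁ x) (inj₁ y) = sym G₁ x y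
  joinSym′ G₁ G₂ (inj₂ x) (inj₂ y) = sym G₂ x y
  joinSym′ G₁ G₂ (inj₁ x) (inj₂ y) = refl
  joinSym′ G₁ G₂ (inj₂ x) (inj₁ y) = refl

  joinIrr′ : (G₁ G₂ : Graph) → ∀ x → joinAdj′ (adj G₁) (adj G₂) x x ≡ false
  joinIrr′ G₁ G₂ (inj₁ x) = irrefl G₁ x
  joinIrr′ G₁ G₂ (inj₂ x) = irrefl G₂ x

join : Graph → Graph → Graph
join G₁ G₂ = record
  { n      = n G₁ + n G₂
  ; adj    = λ i j → joinAdj′ (adj G₁) (adj G₂) (splitAt (n G₁) i) (splitAt (n G₁) j)
  ; sym    = λ i j → joinSym′ G₁ G₂ (splitAt (n G₁) i) (splitAt (n G₁) j)
  ; irrefl = λ i → joinIrr′ G₁ G₂ (splitAt (n G₁) i)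
  }

{-# OPTIONS --safe #-}
module Submission where

-- Label the edges between the two graphs with 1, …, p₁p₂ along a p₁ × p₂ magic rectangle, the edges of
-- G₁ with p₁p₂ + f₁ and those of G₂ with p₁p₂ + |E(G₁)| + f₂. Since rows and columns of the rectangle
-- have constant sums and the graphs are regular, every vertex sum of G₁ grows by the same amount, and so
-- does every vertex sum of G₂; the excluded difference is exactly the one for which a vertex of G₁
-- and a vertex of G₂ would collide. Conversely, a local antimagic labeling of the join colors the two
-- sides properly with disjoint sets of colors, whence the lower bound.
--
-- Magic rectangles of size p × q with p, q ≥ 3 of equal parity are built from pairs of digits (α, τ),
-- standing for the entry qα + τ. The rows come in horizontal bands with prescribed leading digits:
-- bands of four rows ±x, ±y, and a base of three or five (for even order: zero or six) rows that
-- corrects the parity. In a band every column has sum zero; its cells are permuted so that the rows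
-- sum to zero as well, column j being played off against column -j.

open import Defs hiding (sym)
open import Algebra.Bundles using (CommutativeMonoid)
import Algebra.Properties.CommutativeMonoid.Sum as MonoidSum
open import Data.Bool using (Bool; true; false; T; not; if_then_else_; _∧_)
import Data.Bool.Properties as Bool
open import Data.Fin as Fin using (Fin; zero; suc; toℕ; splitAt; _≟_; combine; fromℕ<; punchOut; _↑ˡ_; _↑ʳ_; cast; #_)
open import Data.Fin.Patterns
open import Data.Fin.Permutation as Perm using (Permutation′; _⟨$⟩ʳ_; permutation)
import Data.Fin.Properties as FP
open import Data.Integer using (ℤ; +_; -[1+_]; 0ℤ; ∣_∣) renaming (_+_ to _+ℤ_; _-_ to _-ℤ_; _*_ to _*ℤ_; -_ to -ℤ_)
import Data.Integer.Properties as ℤP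
import Data.Integer.Tactic.RingSolver as ℤR
open import Data.List as List using (List; []; _∷_; length; lookup; map; concatMap; allFin; tabulate; deduplicate)
open import Data.List.Membership.Propositional using (_∈_; find; lose)
import Data.List.Membership.Propositional.Properties as ∈P
import Data.List.Properties as ListP
open import Data.List.Relation.Unary.All as All using (All; []; _∷_)
open import Data.List.Relation.Unary.AllPairs using ([]; _∷_)
open import Data.List.Relation.Unary.Any as Any using (here)
import Data.List.Relation.Unary.Any.Properties as AnyP
import Data.List.Relation.Unary.Unique.DecPropositional.Properties as DecUnique
open import Data.List.Relation.Unary.Unique.Propositional using (Unique)
import Data.List.Relation.Unary.Unique.Propositional.Properties as UniqueP
open import Data.Nat as ℕ using (ℕ; zero; suc; s≤s; z≤n; _<ᵇ_; ⌊_/2⌋; _+_; _*_; _≤_; _%_)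
open import Data.Nat.DivMod using (m*n%n≡0; [m+kn]%n≡m%n)
open import Data.Nat.ListAction using (sum)
import Data.Nat.ListAction.Properties as ListAction
import Data.Nat.Properties as ℕP
import Data.Nat.Tactic.RingSolver as ℕR
open import Data.Product using (_×_; _,_; proj₁; proj₂; ∃; uncurry)
import Data.Product.Properties as ×P
open import Data.Sum as Sum using (_⊎_; inj₁; inj₂; [_,_])
open import Data.Sum.Function.Propositional using (_⊎-↔_)
import Data.Sum.Properties as SumP
open import Data.Vec as Vec using (Vec; []; _∷_)
open import Data.Vec.Functional using (_++_)
open import Function using (_∘_; id; Injective; Equivalence)
open import Function.Construct.Composition using (_↔-∘_)
open import Function.Construct.Symmetry using (↔-sym)
open import Relation.Binary using (tri<; tri≈; tri>)
open import Relation.Binary.PropositionalEquality hiding ([_])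
open import Relation.Nullary using (¬_; yes; no; does; contradiction)
open import Relation.Nullary.Decidable using (True; toWitness; _→-dec_; _×-dec_)
open import Algebra.Properties.AbelianGroup ℤP.+-0-abelianGroup using (∙-cancelˡ)

-- The difficulty lies in the odd rectangles. With an even number of columns, opposite columns
-- cancel and four rows ±x, ±y balance for any x and y. With an odd number, the column labelled 0
-- has no partner, and the leading digits of a row leave a remainder that the other columns must
-- absorb. In the band with index m this comes down to (2m+1)x = (2m+2)y, met by x = 4m+4 and y =
-- 4m+2. These are exactly the two absolute values following those of the earlier bands, so the
-- bands use up the digits without gaps. The balancing consumes 2m+1 pairs of columns outside the
-- five central ones; this is why the construction wants at most as many rows as columns, the other
-- shapes being transposed. Sign changes alone cannot give three base rows: ±2j ±2j ±2j vanishes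
-- only for j = 0. Their trailing digits therefore form a Kotzig array, three rearrangements of the
-- digits with vanishing column sums.

module Σℕ = MonoidSum ℕP.+-0-commutativeMonoid
module Σℤ = MonoidSum ℤP.+-0-commutativeMonoid

-- Permutations from injections

injective⇒surjective : ∀ {n} {f : Fin n → Fin n} → Injective _≡_ _≡_ f → ∀ y → ∃ λ x → f x ≡ y
injective⇒surjective {suc n} {f} inj y with FP.any? (λ x → f x ≟ y)
... | yes hit = hit
... | no miss = contradiction (λ {x} {x′} → avoid-injective {x} {x′}) (FP.<⇒notInjective (ℕP.n<1+n n))
  where
  avoid : Fin (suc n) → Fin n
  avoid x = punchOut {i = y} {j = f x} (λ eq → miss (x , sym eq))
  avoid-injective : Injective _≡_ _≡_ avoid
  avoid-injective eq = inj (FP.punchOut-injective {i = y} (λ eq → miss (_ , sym eq)) (λ eq → miss (_ , sym eq)) eq)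

injective⇒permutation : ∀ {n} (f : Fin n → Fin n) → Injective _≡_ _≡_ f → Permutation′ n
injective⇒permutation f inj = permutation f (proj₁ ∘ onto) (proj₂ ∘ onto) (λ x → inj (proj₂ (onto (f x))))
  where onto = injective⇒surjective inj

arrangement : ∀ {n} (f : Vec (Fin n) n) →
  {True (FP.all? λ i → FP.all? λ j → (Vec.lookup f i ≟ Vec.lookup f j) →-dec (i ≟ j))} → Permutation′ n
arrangement f {inj} = injective⇒permutation (Vec.lookup f) (λ {i} {j} → toWitness inj i j)

-- Digits 0, …, n - 1 are represented by twice their distance from the middle, i.e. by above - below,
-- which makes reversal of the digits a negation.
record Centered (n : ℕ) (z : ℤ) : Set where
  constructor centered
  field
    above below : ℕ
    total       : suc (above ℕ.+ below) ≡ n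
    value       : z ≡ + above -ℤ + below

  digit : Fin n
  digit = fromℕ< (subst (above ℕ.<_) total (s≤s (ℕP.m≤m+n above below)))

  -- That is, z = 2 d - (n - 1) for the digit d, written without subtraction so that sums of digits
  -- can later be compared in the naturals.
  digit-value : + (1 ℕ.+ 2 ℕ.* toℕ digit) ≡ + n +ℤ z
  digit-value rewrite FP.toℕ-fromℕ< (subst (above ℕ.<_) total (s≤s (ℕP.m≤m+n above below))) | value | sym total =
    identity (+ above) (+ below)
    where
    identity : ∀ k l → + 1 +ℤ (k +ℤ (k +ℤ + 0)) ≡ (+ 1 +ℤ (k +ℤ l)) +ℤ (k -ℤ l)
    identity = ℤR.solve-∀

open Centered using (digit; digit-value)

digit-injective : ∀ {n z z′} (c : Centered n z) (c′ : Centered n z′) → digit c ≡ digit c′ → z ≡ z′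
digit-injective {n} c c′ eq =
  ∙-cancelˡ (+ n) _ _
    (trans (sym (digit-value c)) (trans (cong (λ d → + (1 ℕ.+ 2 ℕ.* toℕ d)) eq) (digit-value c′)))

centered-neg : ∀ {n z} → Centered n z → Centered n (-ℤ z)
centered-neg (centered k l refl refl) = centered l k (cong suc (ℕP.+-comm l k)) (identity (+ k) (+ l))
  where
  identity : ∀ k l → -ℤ (k -ℤ l) ≡ l -ℤ k
  identity = ℤR.solve-∀

-- The parity of `n` fixes the parity of the values, so the range grows by one digit at each end
-- rather than by a single digit.
centered-widen : ∀ {n z} → Centered n z → Centered (2 ℕ.+ n) z
centered-widen (centered k l refl refl) = centered (suc k) (suc l) (cong (2 ℕ.+_) (ℕP.+-suc k l)) (identity (+ k) (+ l))
  where
  identity : ∀ k l → k -ℤ l ≡ (+ 1 +ℤ k) -ℤ (+ 1 +ℤ l)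
  identity = ℤR.solve-∀

centered-pos : ∀ t l {n} → suc (t ℕ.+ (l ℕ.+ l)) ≡ n → Centered n (+ t)
centered-pos t l eq = centered (t ℕ.+ l) l (trans (cong suc (ℕP.+-assoc t l l)) eq) (identity (+ t) (+ l))
  where
  identity : ∀ t l → t ≡ (t +ℤ l) -ℤ l
  identity = ℤR.solve-∀

-- Magic rectangles

-- The entries are 0, …, pq - 1; the sums are stated doubled and without subtraction.
record MagicRectangle (p q : ℕ) : Set where
  field
    entry     : Fin p → Fin q → Fin (p ℕ.* q)
    injective : ∀ {i j i′ j′} → entry i j ≡ entry i′ j′ → i ≡ i′ × j ≡ j′
    row-sum   : ∀ i → q ℕ.+ 2 ℕ.* Σℕ.sum (λ j → toℕ (entry i j)) ≡ q ℕ.* (p ℕ.* q)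
    col-sum   : ∀ j → p ℕ.+ 2 ℕ.* Σℕ.sum (λ i → toℕ (entry i j)) ≡ p ℕ.* (p ℕ.* q)

transpose : ∀ {p q} → MagicRectangle p q → MagicRectangle q p
transpose {p} {q} R = record
  { entry     = λ i j → subst Fin (ℕP.*-comm p q) (entry j i)
  ; injective = λ eq → let e = injective (subst-injective (ℕP.*-comm p q) eq) in proj₂ e , proj₁ e
  ; row-sum   = λ i → trans (cong (λ s → p ℕ.+ 2 ℕ.* s) (Σℕ.sum-cong-≗ λ j → toℕ-subst (ℕP.*-comm p q) (entry j i)))
                            (trans (col-sum i) (cong (p ℕ.*_) (ℕP.*-comm p q)))
  ; col-sum   = λ j → trans (cong (λ s → q ℕ.+ 2 ℕ.* s) (Σℕ.sum-cong-≗ λ i → toℕ-subst (ℕP.*-comm p q) (entry j i)))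
                            (trans (row-sum j) (cong (q ℕ.*_) (ℕP.*-comm p q)))
  }
  where
  open MagicRectangle R
  toℕ-subst : ∀ {m n} (eq : m ≡ n) (k : Fin m) → toℕ (subst Fin eq k) ≡ toℕ k
  toℕ-subst refl k = refl

-- Arranged K J v: the columns K j, for j in J, can each be permuted so that the row sums become v.
data Arranged {n} (K : ℤ → Fin n → ℤ) : List ℤ → (Fin n → ℤ) → Set where
  nil  : ∀ {v} → (∀ i → v i ≡ 0ℤ) → Arranged K [] v
  cons : ∀ {j J v w} (π : Permutation′ n) → Arranged K J v →
         (∀ i → w i ≡ K j (π ⟨$⟩ʳ i) +ℤ v i) → Arranged K (j ∷ J) w

module _ {n} {K : ℤ → Fin n → ℤ} where

  columnOrder : ∀ {J v} → Arranged K J v → Fin (length J) → Permutation′ n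
  columnOrder (cons π _ _) zero    = π
  columnOrder (cons _ a _) (suc j) = columnOrder a j

  rowTotal : ∀ {J v} (a : Arranged K J v) i →
             Σℤ.sum (λ j → K (lookup J j) (columnOrder a j ⟨$⟩ʳ i)) ≡ v i
  rowTotal (nil v≡0)     i = sym (v≡0 i)
  rowTotal (cons π a w≡) i = trans (cong (K _ (π ⟨$⟩ʳ i) +ℤ_) (rowTotal a i)) (sym (w≡ i))

  arranged-cong : ∀ {J v w} → (∀ i → v i ≡ w i) → Arranged K J v → Arranged K J w
  arranged-cong v≗w (nil v≡0)     = nil (λ i → trans (sym (v≗w i)) (v≡0 i))
  arranged-cong v≗w (cons π a eq) = cons π a (λ i → trans (sym (v≗w i)) (eq i))

  addColumn : ∀ {j J v} (π : Permutation′ n) → Arranged K J v →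
              Arranged K (j ∷ J) (λ i → K j (π ⟨$⟩ʳ i) +ℤ v i)
  addColumn π a = cons π a (λ _ → refl)

cellValue : ∀ {n} → ℕ → (Fin n → ℤ) → (ℤ → Fin n → ℤ) → ℤ → Fin n → ℤ
cellValue q α τ j i = + q *ℤ α i +ℤ τ j i

-- Injectivity is demanded on `J` only: the Kotzig digits below repeat once labels exceed `b` in
-- absolute value.
record Encodes (q : ℕ) (J : List ℤ) (f : ℤ → ℤ) : Set where
  field
    range     : All (λ j → Centered q (f j)) J
    injective : ∀ j j′ → f (lookup J j) ≡ f (lookup J j′) → lookup J j ≡ lookup J j′

-- A band supplies the rows with leading digits α. In column j the leading digit α i comes with the
-- trailing digit τ j i, so a cell is recovered from its digits however the columns are permuted.
record Band (q : ℕ) (J : List ℤ) (n : ℕ) : Set where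
  field
    α        : Fin n → ℤ
    τ        : ℤ → Fin n → ℤ
    encodes  : ∀ i → Encodes q J (λ j → τ j i)
    col-zero : ∀ j → Σℤ.sum (cellValue q α τ j) ≡ 0ℤ
    arranged : Arranged (cellValue q α τ) J (λ _ → 0ℤ)

-- The bridge from signed values to actual entries: along any line, the deviations `D` decide how
-- far the doubled sum is from that of a magic line, so vanishing deviations make the line sum
-- constant.
scaled-sum : ∀ P {n} (f : Fin n → ℕ) (D : Fin n → ℤ) → (∀ i → + (1 ℕ.+ 2 ℕ.* f i) ≡ + P +ℤ D i) →
             + (n ℕ.+ 2 ℕ.* Σℕ.sum f) ≡ + (n ℕ.* P) +ℤ Σℤ.sum D
scaled-sum P {zero}  f D eq = refl
scaled-sum P {suc n} f D eq = begin
  + (suc n ℕ.+ 2 ℕ.* (f zero ℕ.+ s))                ≡⟨ cong +_ (regroup n (f zero) s) ⟩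
  + (1 ℕ.+ 2 ℕ.* f zero) +ℤ + (n ℕ.+ 2 ℕ.* s)       ≡⟨ cong₂ _+ℤ_ (eq zero) (scaled-sum P (f ∘ suc) (D ∘ suc) (eq ∘ suc)) ⟩
  (+ P +ℤ D zero) +ℤ (+ (n ℕ.* P) +ℤ d)            ≡⟨ exchange (+ P) (D zero) (+ (n ℕ.* P)) d ⟩
  + (P ℕ.+ n ℕ.* P) +ℤ (D zero +ℤ d)               ∎
  where
  open ≡-Reasoning
  s = Σℕ.sum (f ∘ suc)
  d = Σℤ.sum (D ∘ suc)
  regroup : ∀ n x y → suc n ℕ.+ 2 ℕ.* (x ℕ.+ y) ≡ (1 ℕ.+ 2 ℕ.* x) ℕ.+ (n ℕ.+ 2 ℕ.* y)
  regroup = ℕR.solve-∀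
  exchange : ∀ a b c d → (a +ℤ b) +ℤ (c +ℤ d) ≡ (a +ℤ c) +ℤ (b +ℤ d)
  exchange = ℤR.solve-∀

scaled-sum-zero : ∀ P {n} (f : Fin n → ℕ) (D : Fin n → ℤ) → (∀ i → + (1 ℕ.+ 2 ℕ.* f i) ≡ + P +ℤ D i) →
                  Σℤ.sum D ≡ 0ℤ → n ℕ.+ 2 ℕ.* Σℕ.sum f ≡ n ℕ.* P
scaled-sum-zero P {n} f D eq D≡0 =
  ℤP.+-injective (trans (scaled-sum P f D eq) (trans (cong (+ (n ℕ.* P) +ℤ_) D≡0) (ℤP.+-identityʳ _)))

lookup-injective : ∀ {A : Set} {xs : List A} → Unique xs → Injective _≡_ _≡_ (lookup xs)
lookup-injective (_ ∷ _) {zero}  {zero}  _  = refl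
lookup-injective (x∉ ∷ _) {zero}  {suc j} eq = contradiction eq (All.lookup x∉ (∈P.∈-lookup j))
lookup-injective (x∉ ∷ _) {suc i} {zero}  eq = contradiction (sym eq) (All.lookup x∉ (∈P.∈-lookup i))
lookup-injective (_ ∷ u) {suc i} {suc j} eq = cong suc (lookup-injective u eq)

-- Permuting a column leaves its sum alone, so `col-zero` survives the arrangement that balances the
-- rows. An entry determines its position in three stages: the leading digit gives the row of the
-- band, within that row the trailing digit gives the column, and the column's own permutation is
-- then undone.
rectangle : ∀ {p q J} → length J ≡ q → (B : Band q J p) → Unique J →
            (∀ i → Centered p (Band.α B i)) → Injective _≡_ _≡_ (Band.α B) → MagicRectangle p q
rectangle {p} {q} {J} refl B unique α-range α-injective = record
  { entry     = entry
  ; injective = λ {i} {j} {i′} {j′} → entry-injective i j i′ j′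
  ; row-sum   = λ i → scaled-sum-zero (p ℕ.* q) _ _ (entry-value i) (rowTotal arranged i)
  ; col-sum   = λ j → scaled-sum-zero (p ℕ.* q) _ _ (λ i → entry-value i j)
                        (trans (sym (Σℤ.sum-permute (cellValue q α τ (lookup J j)) (arrange j))) (col-zero (lookup J j)))
  }
  where
  open Band B
  arrange = columnOrder arranged
  τ-range : ∀ i j → Centered q (τ (lookup J j) i)
  τ-range i j = All.lookup (Encodes.range (encodes i)) (∈P.∈-lookup j)

  entry : Fin p → Fin q → Fin (p ℕ.* q)
  entry i j = combine (digit (α-range (arrange j ⟨$⟩ʳ i))) (digit (τ-range (arrange j ⟨$⟩ʳ i) j))

  -- `cellValue` is the entry e itself, doubled and centred: if 2a + 1 = p + α and 2t + 1 = q + τ,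
  -- then 2(qa + t) + 1 = pq + (qα + τ).
  entry-value : ∀ i j → + (1 ℕ.+ 2 ℕ.* toℕ (entry i j)) ≡ + (p ℕ.* q) +ℤ cellValue q α τ (lookup J j) (arrange j ⟨$⟩ʳ i)
  entry-value i j = begin
    + (1 ℕ.+ 2 ℕ.* toℕ (entry i j))                    ≡⟨ cong (λ e → + (1 ℕ.+ 2 ℕ.* e)) (FP.toℕ-combine k k′) ⟩
    + (1 ℕ.+ 2 ℕ.* (q ℕ.* toℕ k ℕ.+ toℕ k′))           ≡⟨ expand ⟩
    + q *ℤ (+ (1 ℕ.+ 2 ℕ.* toℕ k) -ℤ + 1) +ℤ + (1 ℕ.+ 2 ℕ.* toℕ k′)
      ≡⟨ cong₂ (λ x y → + q *ℤ (x -ℤ + 1) +ℤ y) (digit-value (α-range r)) (digit-value (τ-range r j)) ⟩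
    + q *ℤ ((+ p +ℤ α r) -ℤ + 1) +ℤ (+ q +ℤ τ (lookup J j) r)
      ≡⟨ collect (+ p) (+ q) (α r) (τ (lookup J j) r) ⟩
    + p *ℤ + q +ℤ (+ q *ℤ α r +ℤ τ (lookup J j) r)    ≡⟨ cong (_+ℤ cellValue q α τ (lookup J j) r) (sym (ℤP.pos-* p q)) ⟩
    + (p ℕ.* q) +ℤ cellValue q α τ (lookup J j) r      ∎
    where
    open ≡-Reasoning
    r = arrange j ⟨$⟩ʳ i
    k = digit (α-range r)
    k′ = digit (τ-range r j)
    regroup : ∀ q k k′ → 1 ℕ.+ 2 ℕ.* (q ℕ.* k ℕ.+ k′) ≡ q ℕ.* (2 ℕ.* k) ℕ.+ (1 ℕ.+ 2 ℕ.* k′)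
    regroup = ℕR.solve-∀
    expand : + (1 ℕ.+ 2 ℕ.* (q ℕ.* toℕ k ℕ.+ toℕ k′)) ≡ + q *ℤ (+ (1 ℕ.+ 2 ℕ.* toℕ k) -ℤ + 1) +ℤ + (1 ℕ.+ 2 ℕ.* toℕ k′)
    expand = trans (cong +_ (regroup q (toℕ k) (toℕ k′)))
                   (cong (_+ℤ + (1 ℕ.+ 2 ℕ.* toℕ k′)) (ℤP.pos-* q (2 ℕ.* toℕ k)))
    collect : ∀ p q a t → q *ℤ ((p +ℤ a) -ℤ + 1) +ℤ (q +ℤ t) ≡ p *ℤ q +ℤ (q *ℤ a +ℤ t)
    collect = ℤR.solve-∀

  entry-injective : ∀ i j i′ j′ → entry i j ≡ entry i′ j′ → i ≡ i′ × j ≡ j′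
  entry-injective i j i′ j′ eq = same-row j≡ r≡ , j≡
    where
    r = arrange j ⟨$⟩ʳ i
    r′ = arrange j′ ⟨$⟩ʳ i′
    r≡ : r ≡ r′
    r≡ = α-injective (digit-injective (α-range r) (α-range r′)
           (FP.combine-injectiveˡ (digit (α-range r)) (digit (τ-range r j)) (digit (α-range r′)) (digit (τ-range r′ j′)) eq))
    τ≡ : τ (lookup J j) r ≡ τ (lookup J j′) r′
    τ≡ = digit-injective (τ-range r j) (τ-range r′ j′)
           (FP.combine-injectiveʳ (digit (α-range r)) (digit (τ-range r j)) (digit (α-range r′)) (digit (τ-range r′ j′)) eq)
    j≡ : j ≡ j′
    j≡ = lookup-injective unique (Encodes.injective (encodes r) j j′ (trans τ≡ (cong (τ (lookup J j′)) (sym r≡))))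
    same-row : j ≡ j′ → arrange j ⟨$⟩ʳ i ≡ arrange j′ ⟨$⟩ʳ i′ → i ≡ i′
    same-row refl eq′ = trans (sym (Perm.inverseˡ (arrange j))) (trans (cong (arrange j Perm.⟨$⟩ˡ_) eq′) (Perm.inverseˡ (arrange j)))

module _ {c ℓ} (M : CommutativeMonoid c ℓ) where

  private
    module M = CommutativeMonoid M
    module ΣM = MonoidSum M

  -- Kept general because the bands need it over the integers and the join needs it over the
  -- naturals.
  sum-splitAt : ∀ m {n} (F : Fin m ⊎ Fin n → M.Carrier) →
    ΣM.sum (λ i → F (splitAt m i)) M.≈ ΣM.sum (F ∘ inj₁) M.∙ ΣM.sum (F ∘ inj₂)
  sum-splitAt zero    F = M.sym (M.identityˡ _)
  sum-splitAt (suc m) F = M.trans (M.∙-congˡ (sum-splitAt m (F ∘ Sum.map₁ suc))) (M.sym (M.assoc _ _ _))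

-- Stacking bands

_⊕_ : ∀ {m n} → Permutation′ m → Permutation′ n → Permutation′ (m ℕ.+ n)
π ⊕ ρ = ↔-sym FP.+↔⊎ ↔-∘ ((π ⊎-↔ ρ) ↔-∘ FP.+↔⊎)

-- Rows and columns vanish in each band separately, so they vanish in the union; every column is
-- permuted independently within the two blocks.
stack : ∀ {q J m n} → Band q J m → Band q J n → Band q J (m ℕ.+ n)
stack {q} {J} {m} {n} A B = record
  { α        = A.α ++ B.α
  ; τ        = λ j → A.τ j ++ B.τ j
  ; encodes  = encodes
  ; col-zero = λ j → trans (Σℤ.sum-cong-≗ (cellValue-++ j))
                       (trans (sum-splitAt ℤP.+-0-commutativeMonoid m [ cellValue q A.α A.τ j , cellValue q B.α B.τ j ]) (cong₂ _+ℤ_ (A.col-zero j) (B.col-zero j)))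
  ; arranged = arranged-cong zero-++ (beside A.arranged B.arranged)
  }
  where
  module A = Band A
  module B = Band B
  τ : ℤ → Fin (m ℕ.+ n) → ℤ
  τ j = A.τ j ++ B.τ j

  cellValue-++ : ∀ j i → cellValue q (A.α ++ B.α) τ j i ≡ (cellValue q A.α A.τ j ++ cellValue q B.α B.τ j) i
  cellValue-++ j i with splitAt m i
  ... | inj₁ _ = refl
  ... | inj₂ _ = refl

  encodes : ∀ i → Encodes q J (λ j → τ j i)
  encodes i with splitAt m i
  ... | inj₁ i₁ = A.encodes i₁
  ... | inj₂ i₂ = B.encodes i₂

  zero-++ : ∀ i → ((λ (_ : Fin m) → 0ℤ) ++ (λ (_ : Fin n) → 0ℤ)) i ≡ 0ℤ
  zero-++ i with splitAt m i
  ... | inj₁ _ = refl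
  ... | inj₂ _ = refl

  beside : ∀ {J v w} → Arranged (cellValue q A.α A.τ) J v → Arranged (cellValue q B.α B.τ) J w →
           Arranged (cellValue q (A.α ++ B.α) τ) J (v ++ w)
  beside {_} {v} {w} (nil v≡0) (nil w≡0) = nil vanish
    where
    vanish : ∀ i → (v ++ w) i ≡ 0ℤ
    vanish i with splitAt m i
    ... | inj₁ i₁ = v≡0 i₁
    ... | inj₂ i₂ = w≡0 i₂
  beside {j ∷ _} {v} {w} (cons {v = v′} π a v≡) (cons {v = w′} ρ b w≡) = cons (π ⊕ ρ) (beside a b) total
    where
    total : ∀ i → (v ++ w) i ≡ cellValue q (A.α ++ B.α) τ j ((π ⊕ ρ) ⟨$⟩ʳ i) +ℤ (v′ ++ w′) i
    total i with splitAt m i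
    ... | inj₁ i₁ rewrite FP.splitAt-↑ˡ m (π ⟨$⟩ʳ i₁) n = v≡ i₁
    ... | inj₂ i₂ rewrite FP.splitAt-↑ʳ m n (ρ ⟨$⟩ʳ i₂) = w≡ i₂

-- Bands for magic rectangles

-- The outermost pair stands at the head, so recursion on the last argument builds arrangements from
-- the centre outwards, one pair of opposite columns at a time.
labels : (ℕ → ℕ) → List ℤ → ℕ → List ℤ
labels g J₀ zero    = J₀
labels g J₀ (suc b) = + suc (g b) ∷ -[1+ g b ] ∷ labels g J₀ b

module _ {g : ℕ → ℕ} (increasing : ∀ n → suc (g n) ℕ.≤ g (suc n))
         {J₀ : List ℤ} (J₀-bound : All (λ z → ∣ z ∣ ℕ.≤ g 0) J₀) where

  labels-bound : ∀ b → All (λ z → ∣ z ∣ ℕ.≤ g b) (labels g J₀ b)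
  labels-bound zero    = J₀-bound
  labels-bound (suc b) = increasing b ∷ increasing b ∷
    All.map (λ z≤ → ℕP.≤-trans z≤ (ℕP.≤-trans (ℕP.n≤1+n _) (increasing b))) (labels-bound b)

  labels-unique : Unique J₀ → ∀ b → Unique (labels g J₀ b)
  labels-unique u zero    = u
  labels-unique u (suc b) = ((λ ()) ∷ new refl) ∷ new refl ∷ labels-unique u b
    where
    new : ∀ {y} → ∣ y ∣ ≡ suc (g b) → All (y ≢_) (labels g J₀ b)
    new y-abs = All.map (λ { z≤ refl → ℕP.1+n≰n (subst (ℕ._≤ g b) y-abs z≤) }) (labels-bound b)

labels-length : ∀ g J₀ b → length (labels g J₀ b) ≡ b ℕ.+ b ℕ.+ length J₀
labels-length g J₀ zero    = refl
labels-length g J₀ (suc b) = cong suc (trans (cong suc (labels-length g J₀ b)) (cong (ℕ._+ length J₀) (sym (ℕP.+-suc b b))))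

-- For q = 2b + 1 the labels are -b, ..., b and the centred digits are their doubles; for q = 2b the
-- labels ±1, ±3, ..., ±(2b - 1) are the centred digits themselves.
oddLabels evenLabels : ℕ → List ℤ
oddLabels  = labels (λ n → n) (0ℤ ∷ [])
evenLabels = labels (λ n → n ℕ.+ n) []

oddLabels-bound : ∀ b → All (λ z → ∣ z ∣ ℕ.≤ b) (oddLabels b)
oddLabels-bound = labels-bound (λ _ → ℕP.≤-refl) (z≤n ∷ [])

oddLabels-unique : ∀ b → Unique (oddLabels b)
oddLabels-unique = labels-unique (λ _ → ℕP.≤-refl) (z≤n ∷ []) ([] ∷ [])

evenLabels-unique : ∀ b → Unique (evenLabels b)
evenLabels-unique = labels-unique (λ n → s≤s (ℕP.+-monoʳ-≤ n (ℕP.n≤1+n n))) [] []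

evenLabels-centered : ∀ b → All (Centered (b ℕ.+ b)) (evenLabels b)
evenLabels-centered zero    = []
evenLabels-centered (suc b) = subst (λ n → All (Centered n) (evenLabels (suc b))) (cong suc (sym (ℕP.+-suc b b)))
  (top ∷ centered-neg top ∷ All.map centered-widen (evenLabels-centered b))
  where
  top : Centered (2 ℕ.+ (b ℕ.+ b)) (+ suc (b ℕ.+ b))
  top = centered-pos (suc (b ℕ.+ b)) 0 (cong suc (ℕP.+-identityʳ (suc (b ℕ.+ b))))

encodes-neg : ∀ {q J f} → Encodes q J f → Encodes q J (λ j → -ℤ f j)
encodes-neg e = record
  { range     = All.map centered-neg range
  ; injective = λ j j′ eq → injective j j′ (ℤP.neg-injective eq)
  }
  where open Encodes e

-- Injectivity survives sign changes that only depend on the absolute value of the label.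
encodes-flip : ∀ {q J f} (s : ℕ → Bool) → (∀ j → f (-ℤ j) ≡ -ℤ f j) → (∀ i j → f i ≡ f j → i ≡ j) →
               Encodes q J f → Encodes q J (λ j → if s ∣ j ∣ then -ℤ f j else f j)
encodes-flip {q} {J} {f} s odd f-injective e = record
  { range     = All.map (λ {j} → flip-range j) (Encodes.range e)
  ; injective = λ i j → flip-injective (lookup J i) (lookup J j)
  }
  where
  flip-range : ∀ j → Centered q (f j) → Centered q (if s ∣ j ∣ then -ℤ f j else f j)
  flip-range j c with s ∣ j ∣
  ... | true  = centered-neg c
  ... | false = c
  opposite-abs : ∀ i j → i ≡ -ℤ j → ∣ i ∣ ≡ ∣ j ∣
  opposite-abs i j refl = ℤP.∣-i∣≡∣i∣ j
  flip-injective : ∀ i j → (if s ∣ i ∣ then -ℤ f i else f i) ≡ (if s ∣ j ∣ then -ℤ f j else f j) → i ≡ j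
  flip-injective i j eq with s ∣ i ∣ in si | s ∣ j ∣ in sj
  ... | true  | true  = f-injective i j (ℤP.neg-injective eq)
  ... | false | false = f-injective i j eq
  ... | true  | false = contradiction (trans (sym si) (trans (cong s (opposite-abs i j (f-injective _ _ (ℤP.neg-injective (trans eq (trans (sym (ℤP.neg-involutive (f j))) (cong -ℤ_ (sym (odd j))))))))) sj)) (λ ())
  ... | false | true  = contradiction (trans (sym si) (trans (cong s (opposite-abs i j (f-injective _ _ (trans eq (sym (odd j)))))) sj)) (λ ())

evenLabels-encodes : ∀ b → Encodes (b ℕ.+ b) (evenLabels b) (λ j → j)
evenLabels-encodes b = record { range = evenLabels-centered b ; injective = λ _ _ eq → eq }

double-injective : ∀ i j → + 2 *ℤ i ≡ + 2 *ℤ j → i ≡ j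
double-injective i j = ℤP.*-cancelˡ-≡ (+ 2) i j

double-centered : ∀ {b} j → ∣ j ∣ ℕ.≤ b → Centered (suc (b ℕ.+ b)) (+ 2 *ℤ j)
double-centered {b} (+ m) m≤b = subst (λ b → Centered (suc (b ℕ.+ b)) (+ 2 *ℤ + m)) (ℕP.m+[n∸m]≡n m≤b)
  (subst (Centered _) (ℤP.pos-* 2 m) (centered-pos (2 ℕ.* m) l (cong suc (regroup m l))))
  where
  l = b ℕ.∸ m
  regroup : ∀ m l → 2 ℕ.* m ℕ.+ (l ℕ.+ l) ≡ (m ℕ.+ l) ℕ.+ (m ℕ.+ l)
  regroup = ℕR.solve-∀
double-centered {b} -[1+ m ] m≤b =
  subst (Centered _) (ℤP.neg-distribʳ-* (+ 2) (+ suc m)) (centered-neg (double-centered (+ suc m) m≤b))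

oddLabels-encodes : ∀ b → Encodes (suc (b ℕ.+ b)) (oddLabels b) (+ 2 *ℤ_)
oddLabels-encodes b = record
  { range     = All.map (λ {j} → double-centered j) (oddLabels-bound b)
  ; injective = λ _ _ → double-injective _ _
  }

-- Kotzig arrays

even : ℕ → Bool
even zero    = true
even (suc n) = not (even n)

even-+double : ∀ n c → even (n ℕ.+ (c ℕ.+ c)) ≡ even n
even-+double zero    zero    = refl
even-+double zero    (suc c) rewrite ℕP.+-suc c c | even-+double zero c = refl
even-+double (suc n) c       = cong not (even-+double n c)

halve : ∀ n → ∃ λ c → n ≡ c ℕ.+ c ⊎ n ≡ suc (c ℕ.+ c)
halve zero    = 0 , inj₁ refl
halve (suc n) with halve n
... | c , inj₁ refl = c , inj₂ refl
... | c , inj₂ refl = suc c , inj₁ (cong suc (sym (ℕP.+-suc c c)))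

parity-gap : ∀ {n b} → n ℕ.≤ b → ∃ λ c → b ≡ n ℕ.+ (c ℕ.+ c) ⊎ b ≡ suc (n ℕ.+ (c ℕ.+ c))
parity-gap {n} {b} n≤b with halve (b ℕ.∸ n)
... | c , inj₁ eq = c , inj₁ (trans (sym (ℕP.m+[n∸m]≡n n≤b)) (cong (n ℕ.+_) eq))
... | c , inj₂ eq = c , inj₂ (trans (sym (ℕP.m+[n∸m]≡n n≤b)) (trans (cong (n ℕ.+_) eq) (ℕP.+-suc n _)))

-- Subtracted from -j, this sends the labels with the parity of `b` to the even digits -2b, ..., 0
-- and the remaining labels to 2, ..., 2b. Within each class -j moves in steps of two, so every
-- digit is met once.
offset : Bool → Bool → ℕ → ℤ
offset true  true  b = + b
offset false false b = + b
offset true  false b = -[1+ b ]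
offset false true  b = -[1+ b ]

-- The triple (2j, kotzig b j, - kotzig b (- j)) sums to zero, and each component runs through
-- the doubled labels when j runs through the labels.
kotzig : ℕ → ℤ → ℤ
kotzig b j = -ℤ j -ℤ offset (even ∣ j ∣) (even b) b

offset-same : ∀ s b → offset s s b ≡ + b
offset-same true  b = refl
offset-same false b = refl

offset-differ : ∀ s b → offset s (not s) b ≡ -[1+ b ]
offset-differ true  b = refl
offset-differ false b = refl

offset-cases : ∀ s t b → offset s t b ≡ + b ⊎ offset s t b ≡ -[1+ b ]
offset-cases true  true  b = inj₁ refl
offset-cases false false b = inj₁ refl
offset-cases true  false b = inj₂ refl
offset-cases false true  b = inj₂ refl

-- Writing `b` as |j| + 2c or |j| + 2c + 1 settles which offset applies, and `c` then gives the
-- distance to the ends of the range explicitly.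
kotzig-centered : ∀ {b} j → ∣ j ∣ ℕ.≤ b → Centered (suc (b ℕ.+ b)) (kotzig b j)
kotzig-centered {b} j j≤b with parity-gap j≤b
kotzig-centered (+ n) _ | c , inj₁ refl
  rewrite even-+double n c | offset-same (even n) (n ℕ.+ (c ℕ.+ c)) =
  subst (Centered _) (value (+ n) (+ c)) (centered-neg (centered-pos (2 ℕ.* (n ℕ.+ c)) c (cong suc (count n c))))
  where
  count : ∀ n c → 2 ℕ.* (n ℕ.+ c) ℕ.+ (c ℕ.+ c) ≡ (n ℕ.+ (c ℕ.+ c)) ℕ.+ (n ℕ.+ (c ℕ.+ c))
  count = ℕR.solve-∀
  value : ∀ n c → -ℤ ((n +ℤ c) +ℤ ((n +ℤ c) +ℤ + 0)) ≡ -ℤ n -ℤ (n +ℤ (c +ℤ c))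
  value = ℤR.solve-∀
kotzig-centered (+ n) _ | c , inj₂ refl
  rewrite even-+double n c | offset-differ (even n) (suc (n ℕ.+ (c ℕ.+ c))) =
  subst (Centered _) (value (+ n) (+ c)) (centered-pos (2 ℕ.* suc c) (n ℕ.+ c) (cong suc (count n c)))
  where
  count : ∀ n c → 2 ℕ.* suc c ℕ.+ ((n ℕ.+ c) ℕ.+ (n ℕ.+ c)) ≡ suc (n ℕ.+ (c ℕ.+ c)) ℕ.+ suc (n ℕ.+ (c ℕ.+ c))
  count = ℕR.solve-∀
  value : ∀ n c → (+ 1 +ℤ c) +ℤ ((+ 1 +ℤ c) +ℤ + 0) ≡ -ℤ n -ℤ (-ℤ (+ 2 +ℤ (n +ℤ (c +ℤ c))))
  value = ℤR.solve-∀
kotzig-centered -[1+ n ] _ | c , inj₁ refl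
  rewrite even-+double n c | offset-same (not (even n)) (suc n ℕ.+ (c ℕ.+ c)) =
  subst (Centered _) (value (+ suc n) (+ c)) (centered-neg (centered-pos (2 ℕ.* c) (suc n ℕ.+ c) (cong suc (count (suc n) c))))
  where
  count : ∀ n c → 2 ℕ.* c ℕ.+ ((n ℕ.+ c) ℕ.+ (n ℕ.+ c)) ≡ (n ℕ.+ (c ℕ.+ c)) ℕ.+ (n ℕ.+ (c ℕ.+ c))
  count = ℕR.solve-∀
  value : ∀ n c → -ℤ (c +ℤ (c +ℤ + 0)) ≡ -ℤ (-ℤ n) -ℤ (n +ℤ (c +ℤ c))
  value = ℤR.solve-∀
kotzig-centered -[1+ n ] _ | c , inj₂ refl
  rewrite even-+double n c | offset-differ (not (even n)) (suc (suc n ℕ.+ (c ℕ.+ c))) =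
  subst (Centered _) (value (+ suc n) (+ c)) (centered-pos (2 ℕ.* (suc n ℕ.+ suc c)) c (cong suc (count (suc n) c)))
  where
  count : ∀ n c → 2 ℕ.* (n ℕ.+ suc c) ℕ.+ (c ℕ.+ c) ≡ suc (n ℕ.+ (c ℕ.+ c)) ℕ.+ suc (n ℕ.+ (c ℕ.+ c))
  count = ℕR.solve-∀
  value : ∀ n c → (n +ℤ (+ 1 +ℤ c)) +ℤ ((n +ℤ (+ 1 +ℤ c)) +ℤ + 0) ≡ -ℤ (-ℤ n) -ℤ (-ℤ (+ 2 +ℤ (n +ℤ (c +ℤ c))))
  value = ℤR.solve-∀

-- Equal offsets cancel. Different offsets are 2b + 1 apart, whereas two labels differ by at most
-- 2b.
kotzig-injective : ∀ {b} i j → ∣ i ∣ ℕ.≤ b → ∣ j ∣ ℕ.≤ b → kotzig b i ≡ kotzig b j → i ≡ j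
kotzig-injective {b} i j i≤b j≤b eq = by-offsets (offset-cases (even ∣ i ∣) (even b) b) (offset-cases (even ∣ j ∣) (even b) b)
  where
  hᵢ = offset (even ∣ i ∣) (even b) b
  hⱼ = offset (even ∣ j ∣) (even b) b
  difference : j -ℤ i ≡ hᵢ -ℤ hⱼ
  difference = trans (add i j hᵢ) (trans (cong (λ k → k +ℤ (j +ℤ hᵢ)) eq) (cancel j hᵢ hⱼ))
    where
    add : ∀ i j h → j -ℤ i ≡ (-ℤ i -ℤ h) +ℤ (j +ℤ h)
    add = ℤR.solve-∀
    cancel : ∀ j h h′ → (-ℤ j -ℤ h′) +ℤ (j +ℤ h) ≡ h -ℤ h′
    cancel = ℤR.solve-∀
  close : ∣ j -ℤ i ∣ ℕ.≤ b ℕ.+ b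
  close = ℕP.≤-trans (ℤP.∣i-j∣≤∣i∣+∣j∣ j i) (ℕP.+-mono-≤ j≤b i≤b)
  equal : hᵢ ≡ hⱼ → i ≡ j
  equal h≡ = sym (ℤP.i-j≡0⇒i≡j j i (trans difference (ℤP.i≡j⇒i-j≡0 h≡)))
  far : ∣ hᵢ -ℤ hⱼ ∣ ≡ suc (b ℕ.+ b) → i ≡ j
  far h-far = contradiction close (ℕP.<⇒≱ (subst (b ℕ.+ b ℕ.<_) (sym (trans (cong ∣_∣ difference) h-far)) ℕP.≤-refl))
  by-offsets : hᵢ ≡ + b ⊎ hᵢ ≡ -[1+ b ] → hⱼ ≡ + b ⊎ hⱼ ≡ -[1+ b ] → i ≡ j
  by-offsets (inj₁ p) (inj₁ q) = equal (trans p (sym q))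
  by-offsets (inj₂ p) (inj₂ q) = equal (trans p (sym q))
  by-offsets (inj₁ p) (inj₂ q) = far (trans (cong₂ (λ x y → ∣ x -ℤ y ∣) p q) (ℕP.+-suc b b))
  by-offsets (inj₂ p) (inj₁ q) = far (trans (cong₂ (λ x y → ∣ x -ℤ y ∣) p q)
                                            (cong ∣_∣ (sym (ℤP.neg-distrib-+ (+ suc b) (+ b)))))

kotzig-encodes : ∀ b → Encodes (suc (b ℕ.+ b)) (oddLabels b) (kotzig b)
kotzig-encodes b = record
  { range     = All.map (λ {j} → kotzig-centered j) (oddLabels-bound b)
  ; injective = λ i j → kotzig-injective _ _ (bound i) (bound j)
  }
  where
  bound : ∀ i → ∣ lookup (oddLabels b) i ∣ ℕ.≤ b
  bound i = All.lookup (oddLabels-bound b) (∈P.∈-lookup i)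

kotzig-reflected-encodes : ∀ b → Encodes (suc (b ℕ.+ b)) (oddLabels b) (λ j → -ℤ kotzig b (-ℤ j))
kotzig-reflected-encodes b = record
  { range     = All.map (λ {j} j≤ → centered-neg (kotzig-centered (-ℤ j) (subst (ℕ._≤ b) (sym (ℤP.∣-i∣≡∣i∣ j)) j≤))) (oddLabels-bound b)
  ; injective = λ i j eq → ℤP.neg-injective (kotzig-injective _ _ (bound i) (bound j) (ℤP.neg-injective eq))
  }
  where
  bound : ∀ i → ∣ -ℤ lookup (oddLabels b) i ∣ ℕ.≤ b
  bound i = subst (ℕ._≤ b) (sym (ℤP.∣-i∣≡∣i∣ (lookup (oddLabels b) i))) (All.lookup (oddLabels-bound b) (∈P.∈-lookup i))

-- Bands of four rows

quad : ℤ → ℤ → Fin 4 → ℤ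
quad x y 0F = x
quad x y 1F = -ℤ x
quad x y 2F = y
quad x y 3F = -ℤ y

-- Near the middle the signs of the trailing digits alternate differently: with the signs used further
-- out, no arrangement of the five central columns has the parities needed to balance the rows.
small : ℕ → Bool
small 0 = true
small 1 = true
small 2 = true
small _ = false

module OddBand (b : ℕ) (x y : ℤ) where

  q : ℕ
  q = suc (b ℕ.+ b)

  τ : ℤ → Fin 4 → ℤ
  τ j 0F = + 2 *ℤ j
  τ j 1F = if small ∣ j ∣ then -ℤ (+ 2 *ℤ j) else + 2 *ℤ j
  τ j 2F = -ℤ (if small ∣ j ∣ then -ℤ (+ 2 *ℤ j) else + 2 *ℤ j)
  τ j 3F = -ℤ (+ 2 *ℤ j)

  encodes : ∀ i → Encodes q (oddLabels b) (λ j → τ j i)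
  encodes 0F = oddLabels-encodes b
  encodes 1F = encodes-flip small (λ j → sym (ℤP.neg-distribʳ-* (+ 2) j)) double-injective (oddLabels-encodes b)
  encodes 2F = encodes-neg (encodes 1F)
  encodes 3F = encodes-neg (oddLabels-encodes b)

  col-zero : ∀ j → Σℤ.sum (cellValue q (quad x y) τ j) ≡ 0ℤ
  col-zero j = cancel (+ q) x y (τ j 0F) (τ j 1F)
    where
    cancel : ∀ q x y s t → (q *ℤ x +ℤ s) +ℤ ((q *ℤ (-ℤ x) +ℤ t) +ℤ ((q *ℤ y +ℤ (-ℤ t)) +ℤ ((q *ℤ (-ℤ y) +ℤ (-ℤ s)) +ℤ + 0))) ≡ + 0
    cancel = ℤR.solve-∀

  -- Every move below keeps the totals of rows 0, 1 and of rows 2, 3 opposite, so two numbers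
  -- describe all four.
  Rows : ℕ → ℤ → ℤ → Set
  Rows c A C = Arranged (cellValue q (quad x y) τ) (oddLabels c) (quad A C)

  -- The trailing digits cancel in each row already. Five leading digits cannot cancel in pairs, so
  -- a multiple of `q` remains, to be removed by the moves on the outer columns.
  central : Rows 2 (+ q *ℤ x) (+ q *ℤ (y +ℤ y -ℤ x))
  central = arranged-cong rows
    (addColumn (arrangement (0F ∷ 2F ∷ 1F ∷ 3F ∷ []))
    (addColumn (arrangement (0F ∷ 2F ∷ 1F ∷ 3F ∷ []))
    (addColumn (arrangement (1F ∷ 3F ∷ 2F ∷ 0F ∷ []))
    (addColumn (arrangement (1F ∷ 3F ∷ 0F ∷ 2F ∷ []))
    (addColumn (arrangement (0F ∷ 1F ∷ 2F ∷ 3F ∷ []))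
    (nil (λ _ → refl)))))))
    where
    row0 : ∀ q x y →
      (q *ℤ x +ℤ + 4) +ℤ ((q *ℤ x +ℤ (-ℤ + 4)) +ℤ ((q *ℤ (-ℤ x) +ℤ (-ℤ + 2)) +ℤ ((q *ℤ (-ℤ x) +ℤ + 2) +ℤ (
      (q *ℤ x +ℤ + 0) +ℤ (+ 0)))))
        ≡ q *ℤ x
    row0 = ℤR.solve-∀
    row1 : ∀ q x y →
      (q *ℤ y +ℤ + 4) +ℤ ((q *ℤ y +ℤ (-ℤ + 4)) +ℤ ((q *ℤ (-ℤ y) +ℤ (-ℤ + 2)) +ℤ ((q *ℤ (-ℤ y) +ℤ + 2) +ℤ (
      (q *ℤ (-ℤ x) +ℤ + 0) +ℤ (+ 0)))))
        ≡ -ℤ (q *ℤ x)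
    row1 = ℤR.solve-∀
    row2 : ∀ q x y →
      (q *ℤ (-ℤ x) +ℤ (-ℤ + 4)) +ℤ ((q *ℤ (-ℤ x) +ℤ + 4) +ℤ ((q *ℤ y +ℤ + 2) +ℤ ((q *ℤ x +ℤ (-ℤ + 2)) +ℤ (
      (q *ℤ y +ℤ + 0) +ℤ (+ 0)))))
        ≡ q *ℤ (y +ℤ y -ℤ x)
    row2 = ℤR.solve-∀
    row3 : ∀ q x y →
      (q *ℤ (-ℤ y) +ℤ (-ℤ + 4)) +ℤ ((q *ℤ (-ℤ y) +ℤ + 4) +ℤ ((q *ℤ x +ℤ + 2) +ℤ ((q *ℤ y +ℤ (-ℤ + 2)) +ℤ (
      (q *ℤ (-ℤ y) +ℤ + 0) +ℤ (+ 0)))))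
        ≡ -ℤ (q *ℤ (y +ℤ y -ℤ x))
    row3 = ℤR.solve-∀
    rows : ∀ i → _ ≡ quad (+ q *ℤ x) (+ q *ℤ (y +ℤ y -ℤ x)) i
    rows 0F = row0 (+ q) x y
    rows 1F = row1 (+ q) x y
    rows 2F = row2 (+ q) x y
    rows 3F = row3 (+ q) x y

  -- Column -z exchanges each row with its opposite, so leading and trailing digits cancel together.
  -- The summands `+ 0` give this the shape of a move that `iterate` accepts.
  neutral : ∀ {c A C} → Rows (2 ℕ.+ c) A C → Rows (3 ℕ.+ c) (A +ℤ + 0) (C +ℤ + 0)
  neutral {c} {A} {C} a = arranged-cong rows
    (addColumn (arrangement (0F ∷ 1F ∷ 2F ∷ 3F ∷ [])) (addColumn (arrangement (1F ∷ 0F ∷ 3F ∷ 2F ∷ [])) a))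
    where
    row0 : ∀ q x y z A → (q *ℤ x +ℤ + 2 *ℤ z) +ℤ ((q *ℤ (-ℤ x) +ℤ + 2 *ℤ (-ℤ z)) +ℤ (A)) ≡ (A +ℤ + 0)
    row0 = ℤR.solve-∀
    row1 : ∀ q x y z A → (q *ℤ (-ℤ x) +ℤ + 2 *ℤ z) +ℤ ((q *ℤ x +ℤ + 2 *ℤ (-ℤ z)) +ℤ (-ℤ A)) ≡ -ℤ (A +ℤ + 0)
    row1 = ℤR.solve-∀
    row2 : ∀ q x y z C → (q *ℤ y +ℤ (-ℤ (+ 2 *ℤ z))) +ℤ ((q *ℤ (-ℤ y) +ℤ (-ℤ (+ 2 *ℤ (-ℤ z)))) +ℤ (C)) ≡ (C +ℤ + 0)
    row2 = ℤR.solve-∀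
    row3 : ∀ q x y z C → (q *ℤ (-ℤ y) +ℤ (-ℤ (+ 2 *ℤ z))) +ℤ ((q *ℤ y +ℤ (-ℤ (+ 2 *ℤ (-ℤ z)))) +ℤ (-ℤ C)) ≡ -ℤ (C +ℤ + 0)
    row3 = ℤR.solve-∀
    z = + suc (2 ℕ.+ c)
    rows : ∀ i → _ ≡ quad (A +ℤ + 0) (C +ℤ + 0) i
    rows 0F = row0 (+ q) x y z A
    rows 1F = row1 (+ q) x y z A
    rows 2F = row2 (+ q) x y z C
    rows 3F = row3 (+ q) x y z C

  -- Reading the columns z and -z in the same row order cancels the trailing digits and doubles the
  -- leading ones. `retreat` does this with the rows reversed; `adjust` reverses likewise for rows 0
  -- and 1 but is neutral on rows 2 and 3.
  advance : ∀ {c A C} → Rows (2 ℕ.+ c) A C → Rows (3 ℕ.+ c) (A +ℤ (+ q *ℤ x +ℤ + q *ℤ x)) (C +ℤ (+ q *ℤ y +ℤ + q *ℤ y))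
  advance {c} {A} {C} a = arranged-cong rows
    (addColumn (arrangement (0F ∷ 1F ∷ 2F ∷ 3F ∷ [])) (addColumn (arrangement (0F ∷ 1F ∷ 2F ∷ 3F ∷ [])) a))
    where
    row0 : ∀ q x y z A → (q *ℤ x +ℤ + 2 *ℤ z) +ℤ ((q *ℤ x +ℤ + 2 *ℤ (-ℤ z)) +ℤ (A)) ≡ (A +ℤ (q *ℤ x +ℤ q *ℤ x))
    row0 = ℤR.solve-∀
    row1 : ∀ q x y z A → (q *ℤ (-ℤ x) +ℤ + 2 *ℤ z) +ℤ ((q *ℤ (-ℤ x) +ℤ + 2 *ℤ (-ℤ z)) +ℤ (-ℤ A)) ≡ -ℤ (A +ℤ (q *ℤ x +ℤ q *ℤ x))
    row1 = ℤR.solve-∀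
    row2 : ∀ q x y z C → (q *ℤ y +ℤ (-ℤ (+ 2 *ℤ z))) +ℤ ((q *ℤ y +ℤ (-ℤ (+ 2 *ℤ (-ℤ z)))) +ℤ (C)) ≡ (C +ℤ (q *ℤ y +ℤ q *ℤ y))
    row2 = ℤR.solve-∀
    row3 : ∀ q x y z C → (q *ℤ (-ℤ y) +ℤ (-ℤ (+ 2 *ℤ z))) +ℤ ((q *ℤ (-ℤ y) +ℤ (-ℤ (+ 2 *ℤ (-ℤ z)))) +ℤ (-ℤ C)) ≡ -ℤ (C +ℤ (q *ℤ y +ℤ q *ℤ y))
    row3 = ℤR.solve-∀
    z = + suc (2 ℕ.+ c)
    rows : ∀ i → _ ≡ quad (A +ℤ (+ q *ℤ x +ℤ + q *ℤ x)) (C +ℤ (+ q *ℤ y +ℤ + q *ℤ y)) i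
    rows 0F = row0 (+ q) x y z A
    rows 1F = row1 (+ q) x y z A
    rows 2F = row2 (+ q) x y z C
    rows 3F = row3 (+ q) x y z C

  retreat : ∀ {c A C} → Rows (2 ℕ.+ c) A C → Rows (3 ℕ.+ c) (A +ℤ (-ℤ (+ q *ℤ y +ℤ + q *ℤ y))) (C +ℤ (-ℤ (+ q *ℤ x +ℤ + q *ℤ x)))
  retreat {c} {A} {C} a = arranged-cong rows
    (addColumn (arrangement (3F ∷ 2F ∷ 1F ∷ 0F ∷ [])) (addColumn (arrangement (3F ∷ 2F ∷ 1F ∷ 0F ∷ [])) a))
    where
    row0 : ∀ q x y z A → (q *ℤ (-ℤ y) +ℤ (-ℤ (+ 2 *ℤ z))) +ℤ ((q *ℤ (-ℤ y) +ℤ (-ℤ (+ 2 *ℤ (-ℤ z)))) +ℤ (A)) ≡ (A +ℤ (-ℤ (q *ℤ y +ℤ q *ℤ y)))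
    row0 = ℤR.solve-∀
    row1 : ∀ q x y z A → (q *ℤ y +ℤ (-ℤ (+ 2 *ℤ z))) +ℤ ((q *ℤ y +ℤ (-ℤ (+ 2 *ℤ (-ℤ z)))) +ℤ (-ℤ A)) ≡ -ℤ (A +ℤ (-ℤ (q *ℤ y +ℤ q *ℤ y)))
    row1 = ℤR.solve-∀
    row2 : ∀ q x y z C → (q *ℤ (-ℤ x) +ℤ + 2 *ℤ z) +ℤ ((q *ℤ (-ℤ x) +ℤ + 2 *ℤ (-ℤ z)) +ℤ (C)) ≡ (C +ℤ (-ℤ (q *ℤ x +ℤ q *ℤ x)))
    row2 = ℤR.solve-∀
    row3 : ∀ q x y z C → (q *ℤ x +ℤ + 2 *ℤ z) +ℤ ((q *ℤ x +ℤ + 2 *ℤ (-ℤ z)) +ℤ (-ℤ C)) ≡ -ℤ (C +ℤ (-ℤ (q *ℤ x +ℤ q *ℤ x)))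
    row3 = ℤR.solve-∀
    z = + suc (2 ℕ.+ c)
    rows : ∀ i → _ ≡ quad (A +ℤ (-ℤ (+ q *ℤ y +ℤ + q *ℤ y))) (C +ℤ (-ℤ (+ q *ℤ x +ℤ + q *ℤ x))) i
    rows 0F = row0 (+ q) x y z A
    rows 1F = row1 (+ q) x y z A
    rows 2F = row2 (+ q) x y z C
    rows 3F = row3 (+ q) x y z C

  adjust : ∀ {c A C} → Rows (2 ℕ.+ c) A C → Rows (3 ℕ.+ c) (A +ℤ (-ℤ (+ q *ℤ y +ℤ + q *ℤ y))) (C +ℤ + 0)
  adjust {c} {A} {C} a = arranged-cong rows
    (addColumn (arrangement (3F ∷ 2F ∷ 1F ∷ 0F ∷ [])) (addColumn (arrangement (3F ∷ 2F ∷ 0F ∷ 1F ∷ [])) a))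
    where
    row0 : ∀ q x y z A → (q *ℤ (-ℤ y) +ℤ (-ℤ (+ 2 *ℤ z))) +ℤ ((q *ℤ (-ℤ y) +ℤ (-ℤ (+ 2 *ℤ (-ℤ z)))) +ℤ (A)) ≡ (A +ℤ (-ℤ (q *ℤ y +ℤ q *ℤ y)))
    row0 = ℤR.solve-∀
    row1 : ∀ q x y z A → (q *ℤ y +ℤ (-ℤ (+ 2 *ℤ z))) +ℤ ((q *ℤ y +ℤ (-ℤ (+ 2 *ℤ (-ℤ z)))) +ℤ (-ℤ A)) ≡ -ℤ (A +ℤ (-ℤ (q *ℤ y +ℤ q *ℤ y)))
    row1 = ℤR.solve-∀
    row2 : ∀ q x y z C → (q *ℤ (-ℤ x) +ℤ + 2 *ℤ z) +ℤ ((q *ℤ x +ℤ + 2 *ℤ (-ℤ z)) +ℤ (C)) ≡ (C +ℤ + 0)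
    row2 = ℤR.solve-∀
    row3 : ∀ q x y z C → (q *ℤ x +ℤ + 2 *ℤ z) +ℤ ((q *ℤ (-ℤ x) +ℤ + 2 *ℤ (-ℤ z)) +ℤ (-ℤ C)) ≡ -ℤ (C +ℤ + 0)
    row3 = ℤR.solve-∀
    z = + suc (2 ℕ.+ c)
    rows : ∀ i → _ ≡ quad (A +ℤ (-ℤ (+ q *ℤ y +ℤ + q *ℤ y))) (C +ℤ + 0) i
    rows 0F = row0 (+ q) x y z A
    rows 1F = row1 (+ q) x y z A
    rows 2F = row2 (+ q) x y z C
    rows 3F = row3 (+ q) x y z C

  iterate : ∀ {dA dC} → (∀ {c A C} → Rows (2 ℕ.+ c) A C → Rows (3 ℕ.+ c) (A +ℤ dA) (C +ℤ dC)) →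
            ∀ t {c A C} → Rows (2 ℕ.+ c) A C → Rows (2 ℕ.+ (t ℕ.+ c)) (A +ℤ + t *ℤ dA) (C +ℤ + t *ℤ dC)
  iterate {dA} {dC} step zero {c} {A} {C} a = subst₂ (Rows (2 ℕ.+ c)) (none A dA) (none C dC) a
    where
    none : ∀ A d → A ≡ A +ℤ + 0 *ℤ d
    none = ℤR.solve-∀
  iterate {dA} {dC} step (suc t) {c} {A} {C} a =
    subst₂ (Rows (2 ℕ.+ suc (t ℕ.+ c))) (once A dA (+ t)) (once C dC (+ t)) (step (iterate step t a))
    where
    once : ∀ A d t → (A +ℤ t *ℤ d) +ℤ d ≡ A +ℤ (+ 1 +ℤ t) *ℤ d
    once = ℤR.solve-∀

-- The sum of row 0 is q ((2m+1) x - (2m+2) y) = 0 after m advances, m retreats and one adjustment,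
-- and the sum of row 2 is its negative; this is what determines x and y.
oddBand : ∀ m b → 3 ℕ.+ 2 ℕ.* m ℕ.≤ b → Band (suc (b ℕ.+ b)) (oddLabels b) 4
oddBand m b room = record
  { α        = quad x y
  ; τ        = τ
  ; encodes  = encodes
  ; col-zero = col-zero
  ; arranged = arranged-cong vanish
      (subst (λ c → Rows c total-A total-C) fills
        (iterate neutral r (adjust (iterate retreat m (iterate advance m central)))))
  }
  where
  x y : ℤ
  x = + (4 ℕ.+ 4 ℕ.* m)
  y = + (2 ℕ.+ 4 ℕ.* m)
  open OddBand b x y
  r = b ℕ.∸ (3 ℕ.+ 2 ℕ.* m)
  -- The 2m + 1 moves occupy the labels 3, ..., 2m + 3; the `r` pairs beyond them are neutral.
  fills : 2 ℕ.+ (r ℕ.+ suc (m ℕ.+ (m ℕ.+ 0))) ≡ b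
  fills = trans (regroup r m) (ℕP.m∸n+n≡m room)
    where
    regroup : ∀ r m → 2 ℕ.+ (r ℕ.+ suc (m ℕ.+ (m ℕ.+ 0))) ≡ r ℕ.+ (3 ℕ.+ 2 ℕ.* m)
    regroup = ℕR.solve-∀
  total-A = (((+ q *ℤ x +ℤ + m *ℤ (+ q *ℤ x +ℤ + q *ℤ x)) +ℤ + m *ℤ (-ℤ (+ q *ℤ y +ℤ + q *ℤ y))) +ℤ (-ℤ (+ q *ℤ y +ℤ + q *ℤ y))) +ℤ + r *ℤ + 0
  total-C = (((+ q *ℤ (y +ℤ y -ℤ x) +ℤ + m *ℤ (+ q *ℤ y +ℤ + q *ℤ y)) +ℤ + m *ℤ (-ℤ (+ q *ℤ x +ℤ + q *ℤ x))) +ℤ + 0) +ℤ + r *ℤ + 0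
  balance-A : ∀ q μ r → let ν = μ +ℤ (μ +ℤ (μ +ℤ (μ +ℤ + 0))) ; x = + 4 +ℤ ν ; y = + 2 +ℤ ν in
    (((q *ℤ x +ℤ μ *ℤ (q *ℤ x +ℤ q *ℤ x)) +ℤ μ *ℤ (-ℤ (q *ℤ y +ℤ q *ℤ y))) +ℤ (-ℤ (q *ℤ y +ℤ q *ℤ y))) +ℤ r *ℤ + 0 ≡ + 0
  balance-A = ℤR.solve-∀
  balance-C : ∀ q μ r → let ν = μ +ℤ (μ +ℤ (μ +ℤ (μ +ℤ + 0))) ; x = + 4 +ℤ ν ; y = + 2 +ℤ ν in
    (((q *ℤ (y +ℤ y -ℤ x) +ℤ μ *ℤ (q *ℤ y +ℤ q *ℤ y)) +ℤ μ *ℤ (-ℤ (q *ℤ x +ℤ q *ℤ x))) +ℤ + 0) +ℤ r *ℤ + 0 ≡ + 0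
  balance-C = ℤR.solve-∀
  vanish : ∀ i → quad total-A total-C i ≡ 0ℤ
  vanish 0F = balance-A (+ q) (+ m) (+ r)
  vanish 1F = cong -ℤ_ (balance-A (+ q) (+ m) (+ r))
  vanish 2F = balance-C (+ q) (+ m) (+ r)
  vanish 3F = cong -ℤ_ (balance-C (+ q) (+ m) (+ r))

-- There is no label 0, so each pair ±z cancels by itself as in a neutral move. Hence `x` and `y`
-- are arbitrary and the number of rows is not bounded by that of columns.
evenBand : ∀ b (x y : ℤ) → Band (b ℕ.+ b) (evenLabels b) 4
evenBand b x y = record
  { α        = quad x y
  ; τ        = τ
  ; encodes  = encodes
  ; col-zero = λ j → cancel (+ q) x y j
  ; arranged = arranged b
  }
  where
  q = b ℕ.+ b
  τ : ℤ → Fin 4 → ℤ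
  τ j 0F = j
  τ j 1F = j
  τ j 2F = -ℤ j
  τ j 3F = -ℤ j
  encodes : ∀ i → Encodes q (evenLabels b) (λ j → τ j i)
  encodes 0F = evenLabels-encodes b
  encodes 1F = evenLabels-encodes b
  encodes 2F = encodes-neg (evenLabels-encodes b)
  encodes 3F = encodes-neg (evenLabels-encodes b)
  cancel : ∀ q x y j → (q *ℤ x +ℤ j) +ℤ ((q *ℤ (-ℤ x) +ℤ j) +ℤ ((q *ℤ y +ℤ (-ℤ j)) +ℤ ((q *ℤ (-ℤ y) +ℤ (-ℤ j)) +ℤ + 0))) ≡ + 0
  cancel = ℤR.solve-∀
  opposite₁ : ∀ q x z → (q *ℤ x +ℤ z) +ℤ ((q *ℤ (-ℤ x) +ℤ (-ℤ z)) +ℤ + 0) ≡ + 0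
  opposite₁ = ℤR.solve-∀
  opposite₂ : ∀ q x z → (q *ℤ (-ℤ x) +ℤ z) +ℤ ((q *ℤ x +ℤ (-ℤ z)) +ℤ + 0) ≡ + 0
  opposite₂ = ℤR.solve-∀
  arranged : ∀ c → Arranged (cellValue q (quad x y) τ) (evenLabels c) (λ _ → 0ℤ)
  arranged zero    = nil (λ _ → refl)
  arranged (suc c) = arranged-cong rows
    (addColumn (arrangement (0F ∷ 1F ∷ 2F ∷ 3F ∷ [])) (addColumn (arrangement (1F ∷ 0F ∷ 3F ∷ 2F ∷ [])) (arranged c)))
    where
    z = + suc (c ℕ.+ c)
    rows : ∀ i → _ ≡ 0ℤ
    rows 0F = opposite₁ (+ q) x z
    rows 1F = opposite₂ (+ q) x z
    rows 2F = opposite₁ (+ q) y (-ℤ z)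
    rows 3F = opposite₂ (+ q) y (-ℤ z)

-- Base bands of three, five and six rows

-- The offset depends on |j| only, so the two Kotzig terms contain it with opposite signs.
kotzig-sum : ∀ b j → + 2 *ℤ j +ℤ (kotzig b j +ℤ (-ℤ kotzig b (-ℤ j))) ≡ 0ℤ
kotzig-sum b j rewrite ℤP.∣-i∣≡∣i∣ j = cancel j (offset (even ∣ j ∣) (even b) b)
  where
  cancel : ∀ j h → + 2 *ℤ j +ℤ ((-ℤ j -ℤ h) +ℤ (-ℤ (-ℤ (-ℤ j) -ℤ h))) ≡ + 0
  cancel = ℤR.solve-∀

-- The arrangements of the central columns below and in oddBase₅ and evenBase₆ were found by search;
-- they do not depend on the parity of b because they balance the offsets E and O separately.
oddBase₃ : ∀ b (k : ℤ) → 3 ℕ.≤ b → Band (suc (b ℕ.+ b)) (oddLabels b) 3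
oddBase₃ b k 3≤b = record
  { α        = α
  ; τ        = τ
  ; encodes  = encodes
  ; col-zero = λ j → trans (collect (+ q) k (+ 2 *ℤ j) (kotzig b j) (-ℤ kotzig b (-ℤ j))) (kotzig-sum b j)
  ; arranged = subst (λ c → Arranged (cellValue q α τ) (oddLabels c) (λ _ → 0ℤ)) (ℕP.m∸n+n≡m 3≤b) (outward (b ℕ.∸ 3))
  }
  where
  q = suc (b ℕ.+ b)
  E O : ℤ
  E = offset true (even b) b
  O = offset false (even b) b
  α : Fin 3 → ℤ
  α 0F = 0ℤ
  α 1F = k
  α 2F = -ℤ k
  τ : ℤ → Fin 3 → ℤ
  τ j 0F = + 2 *ℤ j
  τ j 1F = kotzig b j
  τ j 2F = -ℤ kotzig b (-ℤ j)
  encodes : ∀ i → Encodes q (oddLabels b) (λ j → τ j i)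
  encodes 0F = oddLabels-encodes b
  encodes 1F = kotzig-encodes b
  encodes 2F = kotzig-reflected-encodes b
  collect : ∀ q k s t u → (q *ℤ + 0 +ℤ s) +ℤ ((q *ℤ k +ℤ t) +ℤ ((q *ℤ (-ℤ k) +ℤ u) +ℤ + 0)) ≡ s +ℤ (t +ℤ u)
  collect = ℤR.solve-∀
  central : Arranged (cellValue q α τ) (oddLabels 3) (λ _ → 0ℤ)
  central = arranged-cong rows
    (addColumn (arrangement (2F ∷ 1F ∷ 0F ∷ []))
    (addColumn (arrangement (2F ∷ 0F ∷ 1F ∷ []))
    (addColumn (arrangement (2F ∷ 0F ∷ 1F ∷ []))
    (addColumn (arrangement (1F ∷ 2F ∷ 0F ∷ []))
    (addColumn (arrangement (1F ∷ 0F ∷ 2F ∷ []))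
    (addColumn (arrangement (1F ∷ 2F ∷ 0F ∷ []))
    (addColumn (arrangement (0F ∷ 1F ∷ 2F ∷ []))
    (nil (λ _ → refl)))))))))
    where
    row0 : ∀ q k E O →
      (q *ℤ (-ℤ k) +ℤ (-ℤ (+ 3 -ℤ O))) +ℤ ((q *ℤ (-ℤ k) +ℤ (-ℤ ((-ℤ + 3) -ℤ O))) +ℤ (
      (q *ℤ (-ℤ k) +ℤ (-ℤ (+ 2 -ℤ E))) +ℤ ((q *ℤ k +ℤ (+ 2 -ℤ E)) +ℤ ((q *ℤ k +ℤ ((-ℤ + 1) -ℤ O)) +ℤ (
      (q *ℤ k +ℤ (+ 1 -ℤ O)) +ℤ ((q *ℤ + 0 +ℤ + 0) +ℤ (+ 0)))))))
        ≡ + 0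
    row0 = ℤR.solve-∀
    row1 : ∀ q k E O →
      (q *ℤ k +ℤ ((-ℤ + 3) -ℤ O)) +ℤ ((q *ℤ + 0 +ℤ (-ℤ + 6)) +ℤ ((q *ℤ + 0 +ℤ + 4) +ℤ (
      (q *ℤ (-ℤ k) +ℤ (-ℤ ((-ℤ + 2) -ℤ E))) +ℤ ((q *ℤ + 0 +ℤ + 2) +ℤ ((q *ℤ (-ℤ k) +ℤ (-ℤ ((-ℤ + 1) -ℤ O))) +ℤ (
      (q *ℤ k +ℤ (+ 0 -ℤ E)) +ℤ (+ 0)))))))
        ≡ + 0
    row1 = ℤR.solve-∀
    row2 : ∀ q k E O →
      (q *ℤ + 0 +ℤ + 6) +ℤ ((q *ℤ k +ℤ (+ 3 -ℤ O)) +ℤ ((q *ℤ k +ℤ ((-ℤ + 2) -ℤ E)) +ℤ ((q *ℤ + 0 +ℤ (-ℤ + 4)) +ℤ (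
      (q *ℤ (-ℤ k) +ℤ (-ℤ (+ 1 -ℤ O))) +ℤ ((q *ℤ + 0 +ℤ (-ℤ + 2)) +ℤ ((q *ℤ (-ℤ k) +ℤ (-ℤ (+ 0 -ℤ E))) +ℤ (+ 0)))))))
        ≡ + 0
    row2 = ℤR.solve-∀
    rows : ∀ i → _ ≡ 0ℤ
    rows 0F = row0 (+ q) k E O
    rows 1F = row1 (+ q) k E O
    rows 2F = row2 (+ q) k E O

  -- Negating the label exchanges the two Kotzig rows up to sign, so interchanging rows 1 and 2 in
  -- column -z cancels column z.
  outward : ∀ t → Arranged (cellValue q α τ) (oddLabels (t ℕ.+ 3)) (λ _ → 0ℤ)
  outward zero    = central
  outward (suc t) = arranged-cong rows
    (addColumn (arrangement (0F ∷ 1F ∷ 2F ∷ [])) (addColumn (arrangement (0F ∷ 2F ∷ 1F ∷ [])) (outward t)))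
    where
    z = + suc (t ℕ.+ 3)
    row0 : ∀ q z → (q *ℤ + 0 +ℤ + 2 *ℤ z) +ℤ ((q *ℤ + 0 +ℤ + 2 *ℤ (-ℤ z)) +ℤ + 0) ≡ + 0
    row0 = ℤR.solve-∀
    row1 : ∀ q k w → (q *ℤ k +ℤ w) +ℤ ((q *ℤ (-ℤ k) +ℤ (-ℤ w)) +ℤ + 0) ≡ + 0
    row1 = ℤR.solve-∀
    row2 : ∀ q k w → (q *ℤ (-ℤ k) +ℤ (-ℤ w)) +ℤ ((q *ℤ k +ℤ w) +ℤ + 0) ≡ + 0
    row2 = ℤR.solve-∀
    rows : ∀ i → _ ≡ 0ℤ
    rows 0F = row0 (+ q) z
    rows 1F = row1 (+ q) k (kotzig b z)
    rows 2F = row2 (+ q) k (kotzig b (-ℤ z))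

oddBase₅ : ∀ b (k l : ℤ) → 3 ℕ.≤ b → Band (suc (b ℕ.+ b)) (oddLabels b) 5
oddBase₅ b k l 3≤b = record
  { α        = α
  ; τ        = τ
  ; encodes  = encodes
  ; col-zero = λ j → trans (collect (+ q) k l (+ 2 *ℤ j) (kotzig b j) (-ℤ kotzig b (-ℤ j))) (kotzig-sum b j)
  ; arranged = subst (λ c → Arranged (cellValue q α τ) (oddLabels c) (λ _ → 0ℤ)) (ℕP.m∸n+n≡m 3≤b) (outward (b ℕ.∸ 3))
  }
  where
  q = suc (b ℕ.+ b)
  E O : ℤ
  E = offset true (even b) b
  O = offset false (even b) b
  α : Fin 5 → ℤ
  α 0F = 0ℤ
  α 1F = k
  α 2F = -ℤ k
  α 3F = l
  α 4F = -ℤ l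
  τ : ℤ → Fin 5 → ℤ
  τ j 0F = + 2 *ℤ j
  τ j 1F = kotzig b j
  τ j 2F = -ℤ kotzig b (-ℤ j)
  τ j 3F = + 2 *ℤ j
  τ j 4F = -ℤ (+ 2 *ℤ j)
  encodes : ∀ i → Encodes q (oddLabels b) (λ j → τ j i)
  encodes 0F = oddLabels-encodes b
  encodes 1F = kotzig-encodes b
  encodes 2F = kotzig-reflected-encodes b
  encodes 3F = oddLabels-encodes b
  encodes 4F = encodes-neg (oddLabels-encodes b)
  collect : ∀ q k l s t u → (q *ℤ + 0 +ℤ s) +ℤ ((q *ℤ k +ℤ t) +ℤ ((q *ℤ (-ℤ k) +ℤ u) +ℤ ((q *ℤ l +ℤ s) +ℤ ((q *ℤ (-ℤ l) +ℤ (-ℤ s)) +ℤ + 0)))) ≡ s +ℤ (t +ℤ u)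
  collect = ℤR.solve-∀
  central₃ : Arranged (cellValue q α τ) (oddLabels 3) (λ _ → 0ℤ)
  central₃ = arranged-cong rows
    (addColumn (arrangement (4F ∷ 1F ∷ 2F ∷ 0F ∷ 3F ∷ []))
    (addColumn (arrangement (2F ∷ 1F ∷ 4F ∷ 3F ∷ 0F ∷ []))
    (addColumn (arrangement (0F ∷ 2F ∷ 1F ∷ 3F ∷ 4F ∷ []))
    (addColumn (arrangement (2F ∷ 1F ∷ 0F ∷ 3F ∷ 4F ∷ []))
    (addColumn (arrangement (1F ∷ 2F ∷ 3F ∷ 4F ∷ 0F ∷ []))
    (addColumn (arrangement (3F ∷ 2F ∷ 1F ∷ 4F ∷ 0F ∷ []))
    (addColumn (arrangement (1F ∷ 0F ∷ 2F ∷ 4F ∷ 3F ∷ []))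
    (nil (λ _ → refl)))))))))
    where
    row0 : ∀ q k l E O →
      (q *ℤ (-ℤ l) +ℤ (-ℤ + 6)) +ℤ ((q *ℤ (-ℤ k) +ℤ (-ℤ ((-ℤ + 3) -ℤ O))) +ℤ ((q *ℤ + 0 +ℤ + 4) +ℤ (
      (q *ℤ (-ℤ k) +ℤ (-ℤ ((-ℤ + 2) -ℤ E))) +ℤ ((q *ℤ k +ℤ ((-ℤ + 1) -ℤ O)) +ℤ ((q *ℤ l +ℤ (-ℤ + 2)) +ℤ (
      (q *ℤ k +ℤ (+ 0 -ℤ E)) +ℤ (+ 0)))))))
        ≡ + 0
    row0 = ℤR.solve-∀
    row1 : ∀ q k l E O →
      (q *ℤ k +ℤ ((-ℤ + 3) -ℤ O)) +ℤ ((q *ℤ k +ℤ (+ 3 -ℤ O)) +ℤ ((q *ℤ (-ℤ k) +ℤ (-ℤ (+ 2 -ℤ E))) +ℤ (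
      (q *ℤ k +ℤ (+ 2 -ℤ E)) +ℤ ((q *ℤ (-ℤ k) +ℤ (-ℤ (+ 1 -ℤ O))) +ℤ ((q *ℤ (-ℤ k) +ℤ (-ℤ ((-ℤ + 1) -ℤ O))) +ℤ (
      (q *ℤ + 0 +ℤ + 0) +ℤ (+ 0)))))))
        ≡ + 0
    row1 = ℤR.solve-∀
    row2 : ∀ q k l E O →
      (q *ℤ (-ℤ k) +ℤ (-ℤ (+ 3 -ℤ O))) +ℤ ((q *ℤ (-ℤ l) +ℤ + 6) +ℤ ((q *ℤ k +ℤ ((-ℤ + 2) -ℤ E)) +ℤ (
      (q *ℤ + 0 +ℤ (-ℤ + 4)) +ℤ ((q *ℤ l +ℤ + 2) +ℤ ((q *ℤ k +ℤ (+ 1 -ℤ O)) +ℤ (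
      (q *ℤ (-ℤ k) +ℤ (-ℤ (+ 0 -ℤ E))) +ℤ (+ 0)))))))
        ≡ + 0
    row2 = ℤR.solve-∀
    row3 : ∀ q k l E O →
      (q *ℤ + 0 +ℤ + 6) +ℤ ((q *ℤ l +ℤ (-ℤ + 6)) +ℤ ((q *ℤ l +ℤ + 4) +ℤ ((q *ℤ l +ℤ (-ℤ + 4)) +ℤ (
      (q *ℤ (-ℤ l) +ℤ (-ℤ + 2)) +ℤ ((q *ℤ (-ℤ l) +ℤ + 2) +ℤ ((q *ℤ (-ℤ l) +ℤ + 0) +ℤ (+ 0)))))))
        ≡ + 0
    row3 = ℤR.solve-∀
    row4 : ∀ q k l E O →
      (q *ℤ l +ℤ + 6) +ℤ ((q *ℤ + 0 +ℤ (-ℤ + 6)) +ℤ ((q *ℤ (-ℤ l) +ℤ (-ℤ + 4)) +ℤ ((q *ℤ (-ℤ l) +ℤ + 4) +ℤ (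
      (q *ℤ + 0 +ℤ + 2) +ℤ ((q *ℤ + 0 +ℤ (-ℤ + 2)) +ℤ ((q *ℤ l +ℤ + 0) +ℤ (+ 0)))))))
        ≡ + 0
    row4 = ℤR.solve-∀
    rows : ∀ i → _ ≡ 0ℤ
    rows 0F = row0 (+ q) k l E O
    rows 1F = row1 (+ q) k l E O
    rows 2F = row2 (+ q) k l E O
    rows 3F = row3 (+ q) k l E O
    rows 4F = row4 (+ q) k l E O

  central₄ : Arranged (cellValue q α τ) (oddLabels 4) (λ _ → 0ℤ)
  central₄ = arranged-cong rows
    (addColumn (arrangement (0F ∷ 4F ∷ 1F ∷ 3F ∷ 2F ∷ []))
    (addColumn (arrangement (0F ∷ 4F ∷ 2F ∷ 1F ∷ 3F ∷ []))
    (addColumn (arrangement (3F ∷ 2F ∷ 1F ∷ 4F ∷ 0F ∷ []))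
    (addColumn (arrangement (2F ∷ 1F ∷ 3F ∷ 0F ∷ 4F ∷ []))
    (addColumn (arrangement (4F ∷ 0F ∷ 3F ∷ 2F ∷ 1F ∷ []))
    (addColumn (arrangement (0F ∷ 3F ∷ 4F ∷ 2F ∷ 1F ∷ []))
    (addColumn (arrangement (4F ∷ 3F ∷ 2F ∷ 0F ∷ 1F ∷ []))
    (addColumn (arrangement (1F ∷ 3F ∷ 4F ∷ 0F ∷ 2F ∷ []))
    (addColumn (arrangement (3F ∷ 4F ∷ 0F ∷ 1F ∷ 2F ∷ []))
    (nil (λ _ → refl)))))))))))
    where
    row0 : ∀ q k l E O →
      (q *ℤ + 0 +ℤ + 8) +ℤ ((q *ℤ + 0 +ℤ (-ℤ + 8)) +ℤ ((q *ℤ l +ℤ + 6) +ℤ (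
      (q *ℤ (-ℤ k) +ℤ (-ℤ ((-ℤ + 3) -ℤ O))) +ℤ ((q *ℤ (-ℤ l) +ℤ (-ℤ + 4)) +ℤ ((q *ℤ + 0 +ℤ (-ℤ + 4)) +ℤ (
      (q *ℤ (-ℤ l) +ℤ (-ℤ + 2)) +ℤ ((q *ℤ k +ℤ (+ 1 -ℤ O)) +ℤ ((q *ℤ l +ℤ + 0) +ℤ (+ 0)))))))))
        ≡ + 0
    row0 = ℤR.solve-∀
    row1 : ∀ q k l E O →
      (q *ℤ (-ℤ l) +ℤ (-ℤ + 8)) +ℤ ((q *ℤ (-ℤ l) +ℤ + 8) +ℤ ((q *ℤ (-ℤ k) +ℤ (-ℤ (+ 3 -ℤ O))) +ℤ (
      (q *ℤ k +ℤ (+ 3 -ℤ O)) +ℤ ((q *ℤ + 0 +ℤ + 4) +ℤ ((q *ℤ l +ℤ (-ℤ + 4)) +ℤ ((q *ℤ l +ℤ + 2) +ℤ (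
      (q *ℤ l +ℤ (-ℤ + 2)) +ℤ ((q *ℤ (-ℤ l) +ℤ + 0) +ℤ (+ 0)))))))))
        ≡ + 0
    row1 = ℤR.solve-∀
    row2 : ∀ q k l E O →
      (q *ℤ k +ℤ ((-ℤ + 4) -ℤ E)) +ℤ ((q *ℤ (-ℤ k) +ℤ (-ℤ ((-ℤ + 4) -ℤ E))) +ℤ ((q *ℤ k +ℤ ((-ℤ + 3) -ℤ O)) +ℤ (
      (q *ℤ l +ℤ (-ℤ + 6)) +ℤ ((q *ℤ l +ℤ + 4) +ℤ ((q *ℤ (-ℤ l) +ℤ + 4) +ℤ ((q *ℤ (-ℤ k) +ℤ (-ℤ (+ 1 -ℤ O))) +ℤ (
      (q *ℤ (-ℤ l) +ℤ + 2) +ℤ ((q *ℤ + 0 +ℤ + 0) +ℤ (+ 0)))))))))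
        ≡ + 0
    row2 = ℤR.solve-∀
    row3 : ∀ q k l E O →
      (q *ℤ l +ℤ + 8) +ℤ ((q *ℤ k +ℤ (+ 4 -ℤ E)) +ℤ ((q *ℤ (-ℤ l) +ℤ (-ℤ + 6)) +ℤ ((q *ℤ + 0 +ℤ (-ℤ + 6)) +ℤ (
      (q *ℤ (-ℤ k) +ℤ (-ℤ (+ 2 -ℤ E))) +ℤ ((q *ℤ (-ℤ k) +ℤ (-ℤ ((-ℤ + 2) -ℤ E))) +ℤ ((q *ℤ + 0 +ℤ + 2) +ℤ (
      (q *ℤ + 0 +ℤ (-ℤ + 2)) +ℤ ((q *ℤ k +ℤ (+ 0 -ℤ E)) +ℤ (+ 0)))))))))
        ≡ + 0
    row3 = ℤR.solve-∀
    row4 : ∀ q k l E O →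
      (q *ℤ (-ℤ k) +ℤ (-ℤ (+ 4 -ℤ E))) +ℤ ((q *ℤ l +ℤ (-ℤ + 8)) +ℤ ((q *ℤ + 0 +ℤ + 6) +ℤ ((q *ℤ (-ℤ l) +ℤ + 6) +ℤ (
      (q *ℤ k +ℤ ((-ℤ + 2) -ℤ E)) +ℤ ((q *ℤ k +ℤ (+ 2 -ℤ E)) +ℤ ((q *ℤ k +ℤ ((-ℤ + 1) -ℤ O)) +ℤ (
      (q *ℤ (-ℤ k) +ℤ (-ℤ ((-ℤ + 1) -ℤ O))) +ℤ ((q *ℤ (-ℤ k) +ℤ (-ℤ (+ 0 -ℤ E))) +ℤ (+ 0)))))))))
        ≡ + 0
    row4 = ℤR.solve-∀
    rows : ∀ i → _ ≡ 0ℤ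
    rows 0F = row0 (+ q) k l E O
    rows 1F = row1 (+ q) k l E O
    rows 2F = row2 (+ q) k l E O
    rows 3F = row3 (+ q) k l E O
    rows 4F = row4 (+ q) k l E O

  -- In rows 3 and 4 a single pair ±z cancels its trailing digits but leaves ±2l. Two pairs with
  -- opposite signs are therefore added at once, and both parities need a starting arrangement.
  outward : ∀ t → Arranged (cellValue q α τ) (oddLabels (t ℕ.+ 3)) (λ _ → 0ℤ)
  outward 0             = central₃
  outward 1             = central₄
  outward (suc (suc t)) = arranged-cong rows
    (addColumn (arrangement (0F ∷ 1F ∷ 2F ∷ 4F ∷ 3F ∷ [])) (addColumn (arrangement (0F ∷ 2F ∷ 1F ∷ 4F ∷ 3F ∷ []))
      (addColumn (arrangement (0F ∷ 1F ∷ 2F ∷ 3F ∷ 4F ∷ [])) (addColumn (arrangement (0F ∷ 2F ∷ 1F ∷ 3F ∷ 4F ∷ [])) (outward t)))))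
    where
    y = + suc (t ℕ.+ 3)
    z = + suc (suc (t ℕ.+ 3))
    row0 : ∀ q y z → (q *ℤ + 0 +ℤ + 2 *ℤ z) +ℤ ((q *ℤ + 0 +ℤ + 2 *ℤ (-ℤ z)) +ℤ ((q *ℤ + 0 +ℤ + 2 *ℤ y) +ℤ ((q *ℤ + 0 +ℤ + 2 *ℤ (-ℤ y)) +ℤ + 0))) ≡ + 0
    row0 = ℤR.solve-∀
    row1 : ∀ q k v w → (q *ℤ k +ℤ w) +ℤ ((q *ℤ (-ℤ k) +ℤ (-ℤ w)) +ℤ ((q *ℤ k +ℤ v) +ℤ ((q *ℤ (-ℤ k) +ℤ (-ℤ v)) +ℤ + 0))) ≡ + 0
    row1 = ℤR.solve-∀
    row2 : ∀ q k v w → (q *ℤ (-ℤ k) +ℤ (-ℤ w)) +ℤ ((q *ℤ k +ℤ w) +ℤ ((q *ℤ (-ℤ k) +ℤ (-ℤ v)) +ℤ ((q *ℤ k +ℤ v) +ℤ + 0))) ≡ + 0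
    row2 = ℤR.solve-∀
    row3 : ∀ q l y z → (q *ℤ (-ℤ l) +ℤ (-ℤ (+ 2 *ℤ z))) +ℤ ((q *ℤ (-ℤ l) +ℤ (-ℤ (+ 2 *ℤ (-ℤ z)))) +ℤ ((q *ℤ l +ℤ + 2 *ℤ y) +ℤ ((q *ℤ l +ℤ + 2 *ℤ (-ℤ y)) +ℤ + 0))) ≡ + 0
    row3 = ℤR.solve-∀
    row4 : ∀ q l y z → (q *ℤ l +ℤ + 2 *ℤ z) +ℤ ((q *ℤ l +ℤ + 2 *ℤ (-ℤ z)) +ℤ ((q *ℤ (-ℤ l) +ℤ (-ℤ (+ 2 *ℤ y))) +ℤ ((q *ℤ (-ℤ l) +ℤ (-ℤ (+ 2 *ℤ (-ℤ y)))) +ℤ + 0))) ≡ + 0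
    row4 = ℤR.solve-∀
    rows : ∀ i → _ ≡ 0ℤ
    rows 0F = row0 (+ q) y z
    rows 1F = row1 (+ q) k (kotzig b y) (kotzig b z)
    rows 2F = row2 (+ q) k (kotzig b (-ℤ y)) (kotzig b (-ℤ z))
    rows 3F = row3 (+ q) l y z
    rows 4F = row4 (+ q) l y z

-- Three rows must carry j and three -j, so the rows ±z get opposite trailing digits and cannot
-- cancel within one pair of columns. They alternate over two consecutive pairs; the number of pairs
-- being odd, three remain for the centre.
evenBase₆ : ∀ t (x y z : ℤ) → let b = 3 ℕ.+ 2 ℕ.* t in Band (b ℕ.+ b) (evenLabels b) 6
evenBase₆ s x y z = record
  { α        = α
  ; τ        = τ
  ; encodes  = encodes
  ; col-zero = λ j → cancel (+ q) x y z j
  ; arranged = subst (λ c → Arranged (cellValue q α τ) (evenLabels c) (λ _ → 0ℤ)) (fills s) (outward s)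
  }
  where
  b = 3 ℕ.+ 2 ℕ.* s
  q = b ℕ.+ b
  α : Fin 6 → ℤ
  α 0F = x
  α 1F = -ℤ x
  α 2F = y
  α 3F = -ℤ y
  α 4F = z
  α 5F = -ℤ z
  τ : ℤ → Fin 6 → ℤ
  τ j 0F = j
  τ j 1F = j
  τ j 2F = -ℤ j
  τ j 3F = -ℤ j
  τ j 4F = j
  τ j 5F = -ℤ j
  encodes : ∀ i → Encodes q (evenLabels b) (λ j → τ j i)
  encodes 0F = evenLabels-encodes b
  encodes 1F = evenLabels-encodes b
  encodes 2F = encodes-neg (evenLabels-encodes b)
  encodes 3F = encodes-neg (evenLabels-encodes b)
  encodes 4F = evenLabels-encodes b
  encodes 5F = encodes-neg (evenLabels-encodes b)
  fills : ∀ t → t ℕ.+ t ℕ.+ 3 ≡ 3 ℕ.+ 2 ℕ.* t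
  fills = ℕR.solve-∀
  cancel : ∀ q x y z j → (q *ℤ x +ℤ j) +ℤ ((q *ℤ (-ℤ x) +ℤ j) +ℤ ((q *ℤ y +ℤ (-ℤ j)) +ℤ ((q *ℤ (-ℤ y) +ℤ (-ℤ j)) +ℤ ((q *ℤ z +ℤ j) +ℤ ((q *ℤ (-ℤ z) +ℤ (-ℤ j)) +ℤ + 0))))) ≡ + 0
  cancel = ℤR.solve-∀
  central : Arranged (cellValue q α τ) (evenLabels 3) (λ _ → 0ℤ)
  central = arranged-cong rows
    (addColumn (arrangement (1F ∷ 5F ∷ 4F ∷ 0F ∷ 3F ∷ 2F ∷ []))
    (addColumn (arrangement (0F ∷ 3F ∷ 4F ∷ 1F ∷ 2F ∷ 5F ∷ []))
    (addColumn (arrangement (0F ∷ 2F ∷ 5F ∷ 1F ∷ 3F ∷ 4F ∷ []))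
    (addColumn (arrangement (1F ∷ 5F ∷ 3F ∷ 0F ∷ 2F ∷ 4F ∷ []))
    (addColumn (arrangement (0F ∷ 4F ∷ 2F ∷ 3F ∷ 1F ∷ 5F ∷ []))
    (addColumn (arrangement (1F ∷ 4F ∷ 5F ∷ 2F ∷ 0F ∷ 3F ∷ []))
    (nil (λ _ → refl))))))))
    where
    row0 : ∀ q x y z →
      (q *ℤ (-ℤ x) +ℤ + 5) +ℤ ((q *ℤ x +ℤ (-ℤ + 5)) +ℤ ((q *ℤ x +ℤ + 3) +ℤ ((q *ℤ (-ℤ x) +ℤ (-ℤ + 3)) +ℤ (
      (q *ℤ x +ℤ + 1) +ℤ ((q *ℤ (-ℤ x) +ℤ (-ℤ + 1)) +ℤ (+ 0))))))
        ≡ + 0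
    row0 = ℤR.solve-∀
    row1 : ∀ q x y z →
      (q *ℤ (-ℤ z) +ℤ (-ℤ + 5)) +ℤ ((q *ℤ (-ℤ y) +ℤ + 5) +ℤ ((q *ℤ y +ℤ (-ℤ + 3)) +ℤ ((q *ℤ (-ℤ z) +ℤ + 3) +ℤ (
      (q *ℤ z +ℤ + 1) +ℤ ((q *ℤ z +ℤ (-ℤ + 1)) +ℤ (+ 0))))))
        ≡ + 0
    row1 = ℤR.solve-∀
    row2 : ∀ q x y z →
      (q *ℤ z +ℤ + 5) +ℤ ((q *ℤ z +ℤ (-ℤ + 5)) +ℤ ((q *ℤ (-ℤ z) +ℤ (-ℤ + 3)) +ℤ ((q *ℤ (-ℤ y) +ℤ + 3) +ℤ (
      (q *ℤ y +ℤ (-ℤ + 1)) +ℤ ((q *ℤ (-ℤ z) +ℤ + 1) +ℤ (+ 0))))))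
        ≡ + 0
    row2 = ℤR.solve-∀
    row3 : ∀ q x y z →
      (q *ℤ x +ℤ + 5) +ℤ ((q *ℤ (-ℤ x) +ℤ (-ℤ + 5)) +ℤ ((q *ℤ (-ℤ x) +ℤ + 3) +ℤ ((q *ℤ x +ℤ (-ℤ + 3)) +ℤ (
      (q *ℤ (-ℤ y) +ℤ (-ℤ + 1)) +ℤ ((q *ℤ y +ℤ + 1) +ℤ (+ 0))))))
        ≡ + 0
    row3 = ℤR.solve-∀
    row4 : ∀ q x y z →
      (q *ℤ (-ℤ y) +ℤ (-ℤ + 5)) +ℤ ((q *ℤ y +ℤ + 5) +ℤ ((q *ℤ (-ℤ y) +ℤ (-ℤ + 3)) +ℤ ((q *ℤ y +ℤ + 3) +ℤ (
      (q *ℤ (-ℤ x) +ℤ + 1) +ℤ ((q *ℤ x +ℤ (-ℤ + 1)) +ℤ (+ 0))))))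
        ≡ + 0
    row4 = ℤR.solve-∀
    row5 : ∀ q x y z →
      (q *ℤ y +ℤ (-ℤ + 5)) +ℤ ((q *ℤ (-ℤ z) +ℤ + 5) +ℤ ((q *ℤ z +ℤ + 3) +ℤ ((q *ℤ z +ℤ (-ℤ + 3)) +ℤ (
      (q *ℤ (-ℤ z) +ℤ (-ℤ + 1)) +ℤ ((q *ℤ (-ℤ y) +ℤ + 1) +ℤ (+ 0))))))
        ≡ + 0
    row5 = ℤR.solve-∀
    rows : ∀ i → _ ≡ 0ℤ
    rows 0F = row0 (+ q) x y z
    rows 1F = row1 (+ q) x y z
    rows 2F = row2 (+ q) x y z
    rows 3F = row3 (+ q) x y z
    rows 4F = row4 (+ q) x y z
    rows 5F = row5 (+ q) x y z

  outward : ∀ t → Arranged (cellValue q α τ) (evenLabels (t ℕ.+ t ℕ.+ 3)) (λ _ → 0ℤ)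
  outward zero    = central
  outward (suc t) = subst (λ c → Arranged (cellValue q α τ) (evenLabels c) (λ _ → 0ℤ)) (cong (λ n → suc (n ℕ.+ 3)) (sym (ℕP.+-suc t t))) (arranged-cong rows
    (addColumn (arrangement (0F ∷ 1F ∷ 2F ∷ 3F ∷ 5F ∷ 4F ∷ [])) (addColumn (arrangement (1F ∷ 0F ∷ 3F ∷ 2F ∷ 5F ∷ 4F ∷ []))
      (addColumn (arrangement (0F ∷ 1F ∷ 2F ∷ 3F ∷ 4F ∷ 5F ∷ [])) (addColumn (arrangement (1F ∷ 0F ∷ 3F ∷ 2F ∷ 4F ∷ 5F ∷ [])) (outward t))))))
    where
    c = t ℕ.+ t ℕ.+ 3
    v = + suc (c ℕ.+ c)
    w = + suc (suc c ℕ.+ suc c)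
    opposite₁ : ∀ q x v w → (q *ℤ x +ℤ w) +ℤ ((q *ℤ (-ℤ x) +ℤ (-ℤ w)) +ℤ ((q *ℤ x +ℤ v) +ℤ ((q *ℤ (-ℤ x) +ℤ (-ℤ v)) +ℤ + 0))) ≡ + 0
    opposite₁ = ℤR.solve-∀
    opposite₂ : ∀ q x v w → (q *ℤ (-ℤ x) +ℤ w) +ℤ ((q *ℤ x +ℤ (-ℤ w)) +ℤ ((q *ℤ (-ℤ x) +ℤ v) +ℤ ((q *ℤ x +ℤ (-ℤ v)) +ℤ + 0))) ≡ + 0
    opposite₂ = ℤR.solve-∀
    alternate₁ : ∀ q z v w → (q *ℤ (-ℤ z) +ℤ (-ℤ w)) +ℤ ((q *ℤ (-ℤ z) +ℤ (-ℤ (-ℤ w))) +ℤ ((q *ℤ z +ℤ v) +ℤ ((q *ℤ z +ℤ (-ℤ v)) +ℤ + 0))) ≡ + 0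
    alternate₁ = ℤR.solve-∀
    alternate₂ : ∀ q z v w → (q *ℤ z +ℤ w) +ℤ ((q *ℤ z +ℤ (-ℤ w)) +ℤ ((q *ℤ (-ℤ z) +ℤ (-ℤ v)) +ℤ ((q *ℤ (-ℤ z) +ℤ (-ℤ (-ℤ v))) +ℤ + 0))) ≡ + 0
    alternate₂ = ℤR.solve-∀
    rows : ∀ i → _ ≡ 0ℤ
    rows 0F = opposite₁ (+ q) x v w
    rows 1F = opposite₂ (+ q) x v w
    rows 2F = opposite₁ (+ q) y (-ℤ v) (-ℤ w)
    rows 3F = opposite₂ (+ q) y (-ℤ v) (-ℤ w)
    rows 4F = alternate₁ (+ q) z v w
    rows 5F = alternate₂ (+ q) z v w

-- Rectangles with fewer columns than the base bands require

explicit : ∀ {p q} (rows : Vec (Vec (Fin (p ℕ.* q)) q) p) →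
  (let entry = λ i j → Vec.lookup (Vec.lookup rows i) j) →
  {True (FP.all? λ i → FP.all? λ j → FP.all? λ i′ → FP.all? λ j′ →
           (entry i j ≟ entry i′ j′) →-dec ((i ≟ i′) ×-dec (j ≟ j′)))} →
  {True (FP.all? λ i → q ℕ.+ 2 ℕ.* Σℕ.sum (λ j → toℕ (entry i j)) ℕ.≟ q ℕ.* (p ℕ.* q))} →
  {True (FP.all? λ j → p ℕ.+ 2 ℕ.* Σℕ.sum (λ i → toℕ (entry i j)) ℕ.≟ p ℕ.* (p ℕ.* q))} →
  MagicRectangle p q
explicit rows {inj} {row} {col} = record
  { entry     = λ i j → Vec.lookup (Vec.lookup rows i) j
  ; injective = λ {i} {j} {i′} {j′} → toWitness inj i j i′ j′
  ; row-sum   = toWitness row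
  ; col-sum   = toWitness col
  }

rectangle₃ₓ₃ : MagicRectangle 3 3
rectangle₃ₓ₃ = explicit
  ((# 2 ∷ # 4 ∷ # 6 ∷ [])
  ∷ (# 7 ∷ # 0 ∷ # 5 ∷ [])
  ∷ (# 3 ∷ # 8 ∷ # 1 ∷ [])
  ∷ [])

rectangle₃ₓ₅ : MagicRectangle 3 5
rectangle₃ₓ₅ = explicit
  ((# 3 ∷ # 2 ∷ # 11 ∷ # 13 ∷ # 6 ∷ [])
  ∷ (# 14 ∷ # 7 ∷ # 9 ∷ # 0 ∷ # 5 ∷ [])
  ∷ (# 4 ∷ # 12 ∷ # 1 ∷ # 8 ∷ # 10 ∷ [])
  ∷ [])

rectangle₅ₓ₅ : MagicRectangle 5 5
rectangle₅ₓ₅ = explicit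
  ((# 23 ∷ # 15 ∷ # 6 ∷ # 0 ∷ # 16 ∷ [])
  ∷ (# 1 ∷ # 18 ∷ # 19 ∷ # 12 ∷ # 10 ∷ [])
  ∷ (# 21 ∷ # 9 ∷ # 17 ∷ # 2 ∷ # 11 ∷ [])
  ∷ (# 8 ∷ # 13 ∷ # 14 ∷ # 22 ∷ # 3 ∷ [])
  ∷ (# 7 ∷ # 5 ∷ # 4 ∷ # 24 ∷ # 20 ∷ [])
  ∷ [])

-- Distinct leading digits

-- Leading digits come in opposite pairs, so distinctness reduces to comparing absolute values.
signed-pair-injective : ∀ {n} (α : Fin (2 ℕ.+ n) → ℤ) → α 1F ≡ -ℤ α 0F → 0 ℕ.< ∣ α 0F ∣ →
  (∀ i → ∣ α (suc (suc i)) ∣ ≢ ∣ α 0F ∣) → Injective _≡_ _≡_ (λ i → α (suc (suc i))) → Injective _≡_ _≡_ α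
signed-pair-injective α opposite nonzero apart inj {i} {j} = go i j
  where
  abs₁ : ∣ α 1F ∣ ≡ ∣ α 0F ∣
  abs₁ = trans (cong ∣_∣ opposite) (ℤP.∣-i∣≡∣i∣ (α 0F))
  self-opposite : ∀ z → z ≡ -ℤ z → ¬ (0 ℕ.< ∣ z ∣)
  self-opposite (+ zero)  _  ()
  self-opposite (+ suc _) ()
  self-opposite -[1+ _ ]  ()
  go : ∀ i j → α i ≡ α j → i ≡ j
  go 0F 0F eq = refl
  go 1F 1F eq = refl
  go 0F 1F eq = contradiction nonzero (self-opposite (α 0F) (trans eq opposite))
  go 1F 0F eq = contradiction nonzero (self-opposite (α 0F) (trans (sym eq) opposite))
  go 0F (suc (suc j)) eq = contradiction (cong ∣_∣ (sym eq)) (apart j)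
  go 1F (suc (suc j)) eq = contradiction (trans (cong ∣_∣ (sym eq)) abs₁) (apart j)
  go (suc (suc i)) 0F eq = contradiction (cong ∣_∣ eq) (apart i)
  go (suc (suc i)) 1F eq = contradiction (trans (cong ∣_∣ eq) abs₁) (apart i)
  go (suc (suc i)) (suc (suc j)) eq = cong (λ k → suc (suc k)) (inj eq)

zero-first-injective : ∀ {n} (α : Fin (suc n) → ℤ) → α 0F ≡ 0ℤ → (∀ i → 0 ℕ.< ∣ α (suc i) ∣) →
  Injective _≡_ _≡_ (λ i → α (suc i)) → Injective _≡_ _≡_ α
zero-first-injective α α₀ nonzero inj {zero}  {zero}  eq = refl
zero-first-injective α α₀ nonzero inj {zero}  {suc j} eq = contradiction (cong ∣_∣ (trans (sym eq) α₀)) (ℕP.>⇒≢ (nonzero j))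
zero-first-injective α α₀ nonzero inj {suc i} {zero}  eq = contradiction (cong ∣_∣ (trans eq α₀)) (ℕP.>⇒≢ (nonzero i))
zero-first-injective α α₀ nonzero inj {suc i} {suc j} eq = cong suc (inj eq)

++-injective : ∀ {m n} (f : Fin m → ℤ) (g : Fin n → ℤ) → Injective _≡_ _≡_ f → Injective _≡_ _≡_ g →
  (∀ i j → ∣ f i ∣ ≢ ∣ g j ∣) → Injective _≡_ _≡_ (f ++ g)
++-injective {m} {n} f g f-inj g-inj apart {i} {j} eq =
  trans (sym (FP.join-splitAt m n i)) (trans (cong (Fin.join m n) (go (splitAt m i) (splitAt m j) eq)) (FP.join-splitAt m n j))
  where
  go : ∀ s t → [ f , g ] s ≡ [ f , g ] t → s ≡ t
  go (inj₁ _) (inj₁ _) eq = cong inj₁ (f-inj eq)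
  go (inj₁ i) (inj₂ j) eq = contradiction (cong ∣_∣ eq) (apart i j)
  go (inj₂ i) (inj₁ j) eq = contradiction (cong ∣_∣ (sym eq)) (apart j i)
  go (inj₂ _) (inj₂ _) eq = cong inj₂ (g-inj eq)

++-all : ∀ {P : ℤ → Set} {m n} {f : Fin m → ℤ} {g : Fin n → ℤ} → (∀ i → P (f i)) → (∀ i → P (g i)) → ∀ i → P ((f ++ g) i)
++-all {m = m} Pf Pg i with splitAt m i
... | inj₁ i₁ = Pf i₁
... | inj₂ i₂ = Pg i₂

quad-injective : ∀ x y → 0 ℕ.< x → 0 ℕ.< y → x ≢ y → Injective _≡_ _≡_ (quad (+ x) (+ y))
quad-injective x y 0<x 0<y x≢y = signed-pair-injective (quad (+ x) (+ y)) refl 0<x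
  (λ { 0F eq → x≢y (sym eq) ; 1F eq → x≢y (sym (trans (sym (ℤP.∣-i∣≡∣i∣ (+ y))) eq)) })
  (signed-pair-injective (λ i → quad (+ x) (+ y) (suc (suc i))) refl 0<y (λ ()) (λ { {()} }))

quad-abs : ∀ {P : ℕ → Set} x y → P x → P y → ∀ i → P ∣ quad (+ x) (+ y) i ∣
quad-abs x y Px Py 0F = Px
quad-abs {P} x y Px Py 1F = subst P (sym (ℤP.∣-i∣≡∣i∣ (+ x))) Px
quad-abs x y Px Py 2F = Py
quad-abs {P} x y Px Py 3F = subst P (sym (ℤP.∣-i∣≡∣i∣ (+ y))) Py

quad-centered : ∀ {n x y} → Centered n x → Centered n y → ∀ i → Centered n (quad x y i)
quad-centered cx cy 0F = cx
quad-centered cx cy 1F = centered-neg cx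
quad-centered cx cy 2F = cy
quad-centered cx cy 3F = centered-neg cy

double-%2 : ∀ n → (n ℕ.+ n) ℕ.% 2 ≡ 0
double-%2 n = trans (cong (ℕ._% 2) (trans (cong (n ℕ.+_) (sym (ℕP.+-identityʳ n))) (ℕP.*-comm 2 n))) (m*n%n≡0 n 2)

suc-double-%2 : ∀ n → suc (n ℕ.+ n) ℕ.% 2 ≡ 1
suc-double-%2 n = trans (cong (λ m → suc m ℕ.% 2) (trans (cong (n ℕ.+_) (sym (ℕP.+-identityʳ n))) (ℕP.*-comm 2 n))) ([m+kn]%n≡m%n 1 n 2)

-- Stacks of four-row bands and their completion by a base

-- The absolute values stay strictly between 0 and `N`, which leaves 0 and everything from `N` on to
-- later bands and to the base.
record Layers (q : ℕ) (J : List ℤ) (n N : ℕ) : Set where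
  field
    band      : Band q J n
  open Band band public using (α)
  field
    positive  : ∀ i → 0 ℕ.< ∣ α i ∣
    bounded   : ∀ i → ∣ α i ∣ ℕ.< N
    injective : Injective _≡_ _≡_ α
    range     : ∀ i → Centered N (α i)

emptyLayers : ∀ {q J N} → Layers q J 0 N
emptyLayers {q} {J} = record
  { band      = record { α = λ () ; τ = λ _ () ; encodes = λ () ; col-zero = λ _ → refl ; arranged = arranged J }
  ; positive  = λ ()
  ; bounded   = λ ()
  ; injective = λ { {()} }
  ; range     = λ ()
  }
  where
  arranged : ∀ {K : ℤ → Fin 0 → ℤ} J → Arranged K J (λ _ → 0ℤ)
  arranged []      = nil (λ ())
  arranged (_ ∷ J) = cons Perm.id (arranged J) (λ ())

addQuad : ∀ {q J n N} (L : Layers q J n N) (B : Band q J 4) → Band.α B ≡ quad (+ (3 ℕ.+ N)) (+ (1 ℕ.+ N)) →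
  Layers q J (n ℕ.+ 4) (4 ℕ.+ N)
addQuad {q} {J} {n} {N} L B α≡ = record
  { band      = stack L.band B
  ; positive  = ++-all {P = λ z → 0 ℕ.< ∣ z ∣} L.positive
                  (via {P = λ z → 0 ℕ.< ∣ z ∣} (quad-abs {P = 0 ℕ.<_} x y (s≤s z≤n) (s≤s z≤n)))
  ; bounded   = ++-all {P = λ z → ∣ z ∣ ℕ.< 4 ℕ.+ N} (λ i → ℕP.≤-trans (L.bounded i) (ℕP.m≤n+m N 4))
                  (via {P = λ z → ∣ z ∣ ℕ.< 4 ℕ.+ N} (quad-abs {P = ℕ._< 4 ℕ.+ N} x y ℕP.≤-refl (ℕP.m≤n+m (2 ℕ.+ N) 2)))
  ; injective = ++-injective L.α (Band.α B) L.injective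
                  (subst (Injective _≡_ _≡_) (sym α≡)
                    (quad-injective x y (s≤s z≤n) (s≤s z≤n) (λ eq → ℕP.m≢1+n+m y {1} (sym eq))))
                  (λ i j eq → ℕP.<⇒≱ (L.bounded i)
                    (subst (N ℕ.≤_) (sym eq) (via {P = λ z → N ℕ.≤ ∣ z ∣} (quad-abs {P = N ℕ.≤_} x y (ℕP.m≤n+m N 3) (ℕP.m≤n+m N 1)) j)))
  ; range     = ++-all {P = Centered (4 ℕ.+ N)} (λ i → centered-widen (centered-widen (L.range i)))
                  (via {P = Centered (4 ℕ.+ N)} (quad-centered (centered-pos x 0 (cong suc (ℕP.+-identityʳ x)))
                                      (centered-pos y 1 (cong suc (ℕP.+-comm y 2)))))
  }
  where
  module L = Layers L
  -- Centred digits of `N` rows have a fixed parity and end at ±(N - 1), so N + 1 and N + 3 are the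
  -- next two absolute values.
  x = 3 ℕ.+ N
  y = 1 ℕ.+ N
  via : ∀ {P : ℤ → Set} → (∀ i → P (quad (+ x) (+ y) i)) → ∀ i → P (Band.α B i)
  via {P} = subst (λ f → ∀ i → P (f i)) (sym α≡)

-- The values that balance `oddBand M` are 3 + N and 1 + N for N = 1 + 4M, exactly the next free
-- ones, hence the `refl`. Its last move reaches the label 2M + 3, which is what the bound on `b`
-- provides for.
oddLayers : ∀ M {b} → 1 ℕ.+ 2 ℕ.* M ℕ.≤ b → Layers (suc (b ℕ.+ b)) (oddLabels b) (4 ℕ.* M) (1 ℕ.+ 4 ℕ.* M)
oddLayers zero    _ = emptyLayers
oddLayers (suc M) {b} room = subst₂ (Layers _ _) (rows M) (width M)
  (addQuad (oddLayers M (ℕP.≤-trans (ℕP.m≤n+m (1 ℕ.+ 2 ℕ.* M) 2) room′)) (oddBand M b room′) refl)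
  where
  shift : ∀ M → 1 ℕ.+ 2 ℕ.* suc M ≡ 3 ℕ.+ 2 ℕ.* M
  shift = ℕR.solve-∀
  room′ : 3 ℕ.+ 2 ℕ.* M ℕ.≤ b
  room′ = subst (ℕ._≤ b) (shift M) room
  rows : ∀ M → 4 ℕ.* M ℕ.+ 4 ≡ 4 ℕ.* suc M
  rows = ℕR.solve-∀
  width : ∀ M → 4 ℕ.+ (1 ℕ.+ 4 ℕ.* M) ≡ 1 ℕ.+ 4 ℕ.* suc M
  width = ℕR.solve-∀

evenLayers : ∀ M b → Layers (b ℕ.+ b) (evenLabels b) (4 ℕ.* M) (4 ℕ.* M)
evenLayers zero    b = emptyLayers
evenLayers (suc M) b = subst₂ (Layers _ _) (rows M) (width M)
  (addQuad (evenLayers M b) (evenBand b (+ (3 ℕ.+ 4 ℕ.* M)) (+ (1 ℕ.+ 4 ℕ.* M))) refl)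
  where
  rows : ∀ M → 4 ℕ.* M ℕ.+ 4 ≡ 4 ℕ.* suc M
  rows = ℕR.solve-∀
  width : ∀ M → 4 ℕ.+ 4 ℕ.* M ≡ 4 ℕ.* suc M
  width = ℕR.solve-∀

closeLayers : ∀ {q J n N k} → length J ≡ q → Unique J → (L : Layers q J n N) (B : Band q J k) →
  (∀ i → Centered (n ℕ.+ k) (Layers.α L i)) → (∀ i → Centered (n ℕ.+ k) (Band.α B i)) →
  Injective _≡_ _≡_ (Band.α B) → (∀ i → ∣ Band.α B i ∣ ≡ 0 ⊎ N ℕ.≤ ∣ Band.α B i ∣) → MagicRectangle (n ℕ.+ k) q
closeLayers {N = N} len unique L B L-range B-range B-injective apart = rectangle len (stack L.band B) unique
  (++-all {P = Centered _} L-range B-range)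
  (++-injective L.α (Band.α B) L.injective B-injective (λ i j eq → separate i j eq (apart j)))
  where
  module L = Layers L
  separate : ∀ i j → ∣ L.α i ∣ ≡ ∣ Band.α B j ∣ → ¬ (∣ Band.α B j ∣ ≡ 0 ⊎ N ℕ.≤ ∣ Band.α B j ∣)
  separate i j eq (inj₁ z) = ℕP.>⇒≢ (L.positive i) (trans eq z)
  separate i j eq (inj₂ N≤) = ℕP.<⇒≱ (L.bounded i) (subst (N ℕ.≤_) (sym eq) N≤)

oddLabels-length : ∀ b → length (oddLabels b) ≡ suc (b ℕ.+ b)
oddLabels-length b = trans (labels-length _ _ b) (ℕP.+-comm (b ℕ.+ b) 1)

evenLabels-length : ∀ b → length (evenLabels b) ≡ b ℕ.+ b
evenLabels-length b = trans (labels-length _ _ b) (ℕP.+-identityʳ (b ℕ.+ b))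

-- The base takes the digits left over, 0 and ±(4M + 2). Since 4M + 3 = 2(2M + 1) + 1, the first
-- bound says that rows do not outnumber columns; the second makes room for the seven central
-- columns of the base.
rectangle-4M+3 : ∀ M {b} → 1 ℕ.+ 2 ℕ.* M ℕ.≤ b → 3 ℕ.≤ b → MagicRectangle (4 ℕ.* M ℕ.+ 3) (suc (b ℕ.+ b))
rectangle-4M+3 M {b} room 3≤b = closeLayers (oddLabels-length b) (oddLabels-unique b) L B
  (λ i → subst (λ n → Centered n (Layers.α L i)) (ℕP.+-comm 3 (4 ℕ.* M)) (centered-widen (Layers.range L i)))
  (λ { 0F → centered (1 ℕ.+ 2 ℕ.* M) (1 ℕ.+ 2 ℕ.* M) (mid M) (sym (ℤP.+-inverseʳ (+ (1 ℕ.+ 2 ℕ.* M)))) ; 1F → top ; 2F → centered-neg top })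
  (zero-first-injective (Band.α B) refl (λ { 0F → s≤s z≤n ; 1F → s≤s z≤n })
    (signed-pair-injective (λ i → Band.α B (suc i)) refl (s≤s z≤n) (λ ()) (λ { {()} })))
  (λ { 0F → inj₁ refl ; 1F → inj₂ (ℕP.n≤1+n _) ; 2F → inj₂ (ℕP.n≤1+n _) })
  where
  L = oddLayers M room
  k = 2 ℕ.+ 4 ℕ.* M
  B = oddBase₃ b (+ k) 3≤b
  mid : ∀ M → suc ((1 ℕ.+ 2 ℕ.* M) ℕ.+ (1 ℕ.+ 2 ℕ.* M)) ≡ 4 ℕ.* M ℕ.+ 3
  mid = ℕR.solve-∀
  top : Centered (4 ℕ.* M ℕ.+ 3) (+ k)
  top = centered-pos k 0 (count M)
    where
    count : ∀ M → suc ((2 ℕ.+ 4 ℕ.* M) ℕ.+ 0) ≡ 4 ℕ.* M ℕ.+ 3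
    count = ℕR.solve-∀

rectangle-4M+5 : ∀ M {b} → 1 ℕ.+ 2 ℕ.* M ℕ.≤ b → 3 ℕ.≤ b → MagicRectangle (4 ℕ.* M ℕ.+ 5) (suc (b ℕ.+ b))
rectangle-4M+5 M {b} room 3≤b = closeLayers (oddLabels-length b) (oddLabels-unique b) L B
  (λ i → subst (λ n → Centered n (Layers.α L i)) (ℕP.+-comm 5 (4 ℕ.* M)) (centered-widen (centered-widen (Layers.range L i))))
  (λ { 0F → centered (2 ℕ.+ 2 ℕ.* M) (2 ℕ.+ 2 ℕ.* M) (mid M) (sym (ℤP.+-inverseʳ (+ (2 ℕ.+ 2 ℕ.* M))))
     ; 1F → low ; 2F → centered-neg low ; 3F → top ; 4F → centered-neg top })
  (zero-first-injective (Band.α B) refl (λ { 0F → s≤s z≤n ; 1F → s≤s z≤n ; 2F → s≤s z≤n ; 3F → s≤s z≤n })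
    (signed-pair-injective (λ i → Band.α B (suc i)) refl (s≤s z≤n)
      (λ { 0F eq → ℕP.m≢1+n+m k {1} (sym eq) ; 1F eq → ℕP.m≢1+n+m k {1} (sym eq) })
      (signed-pair-injective (λ i → Band.α B (suc (suc (suc i)))) refl (s≤s z≤n) (λ ()) (λ { {()} }))))
  (λ { 0F → inj₁ refl ; 1F → inj₂ (ℕP.n≤1+n _) ; 2F → inj₂ (ℕP.n≤1+n _)
     ; 3F → inj₂ (ℕP.m≤n+m _ 3) ; 4F → inj₂ (ℕP.m≤n+m _ 3) })
  where
  L = oddLayers M room
  k = 2 ℕ.+ 4 ℕ.* M
  l = 4 ℕ.+ 4 ℕ.* M
  B = oddBase₅ b (+ k) (+ l) 3≤b
  mid : ∀ M → suc ((2 ℕ.+ 2 ℕ.* M) ℕ.+ (2 ℕ.+ 2 ℕ.* M)) ≡ 4 ℕ.* M ℕ.+ 5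
  mid = ℕR.solve-∀
  low : Centered (4 ℕ.* M ℕ.+ 5) (+ k)
  low = centered-pos k 1 (count M)
    where
    count : ∀ M → suc ((2 ℕ.+ 4 ℕ.* M) ℕ.+ 2) ≡ 4 ℕ.* M ℕ.+ 5
    count = ℕR.solve-∀
  top : Centered (4 ℕ.* M ℕ.+ 5) (+ l)
  top = centered-pos l 0 (count M)
    where
    count : ∀ M → suc ((4 ℕ.+ 4 ℕ.* M) ℕ.+ 0) ≡ 4 ℕ.* M ℕ.+ 5
    count = ℕR.solve-∀

rectangle-4M : ∀ M b → MagicRectangle (4 ℕ.* M) (b ℕ.+ b)
rectangle-4M M b = rectangle (evenLabels-length b) L.band (evenLabels-unique b) L.range L.injective
  where module L = Layers (evenLayers M b)

rectangle-4M+6 : ∀ M t → let b = 3 ℕ.+ 2 ℕ.* t in MagicRectangle (4 ℕ.* M ℕ.+ 6) (b ℕ.+ b)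
rectangle-4M+6 M t = closeLayers (evenLabels-length b) (evenLabels-unique b) L B
  (λ i → subst (λ n → Centered n (Layers.α L i)) (ℕP.+-comm 6 (4 ℕ.* M))
           (centered-widen (centered-widen (centered-widen (Layers.range L i)))))
  (λ { 0F → cx ; 1F → centered-neg cx ; 2F → cy ; 3F → centered-neg cy ; 4F → cz ; 5F → centered-neg cz })
  (signed-pair-injective (Band.α B) refl (s≤s z≤n)
    (λ { 0F eq → ℕP.m≢1+n+m x {1} (sym eq) ; 1F eq → ℕP.m≢1+n+m x {1} (sym eq)
       ; 2F eq → ℕP.m≢1+n+m x {3} (sym eq) ; 3F eq → ℕP.m≢1+n+m x {3} (sym eq) })
    (signed-pair-injective (λ i → Band.α B (suc (suc i))) refl (s≤s z≤n)
      (λ { 0F eq → ℕP.m≢1+n+m y {1} (sym eq) ; 1F eq → ℕP.m≢1+n+m y {1} (sym eq) })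
      (signed-pair-injective (λ i → Band.α B (suc (suc (suc (suc i))))) refl (s≤s z≤n) (λ ()) (λ { {()} }))))
  (λ { 0F → inj₂ (ℕP.m≤n+m _ 1) ; 1F → inj₂ (ℕP.m≤n+m _ 1) ; 2F → inj₂ (ℕP.m≤n+m _ 3) ; 3F → inj₂ (ℕP.m≤n+m _ 3)
     ; 4F → inj₂ (ℕP.m≤n+m _ 5) ; 5F → inj₂ (ℕP.m≤n+m _ 5) })
  where
  b = 3 ℕ.+ 2 ℕ.* t
  L = evenLayers M b
  x = 1 ℕ.+ 4 ℕ.* M
  y = 3 ℕ.+ 4 ℕ.* M
  z = 5 ℕ.+ 4 ℕ.* M
  B = evenBase₆ t (+ x) (+ y) (+ z)
  cx : Centered (4 ℕ.* M ℕ.+ 6) (+ x)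
  cx = centered-pos x 2 (count M)
    where
    count : ∀ M → suc ((1 ℕ.+ 4 ℕ.* M) ℕ.+ 4) ≡ 4 ℕ.* M ℕ.+ 6
    count = ℕR.solve-∀
  cy : Centered (4 ℕ.* M ℕ.+ 6) (+ y)
  cy = centered-pos y 1 (count M)
    where
    count : ∀ M → suc ((3 ℕ.+ 4 ℕ.* M) ℕ.+ 2) ≡ 4 ℕ.* M ℕ.+ 6
    count = ℕR.solve-∀
  cz : Centered (4 ℕ.* M ℕ.+ 6) (+ z)
  cz = centered-pos z 0 (count M)
    where
    count : ∀ M → suc ((5 ℕ.+ 4 ℕ.* M) ℕ.+ 0) ≡ 4 ℕ.* M ℕ.+ 6
    count = ℕR.solve-∀

-- Magic rectangles of all shapes

-- The parity of `a` decides whether 2a + 1 is 3 or 1 modulo 4, hence whether the base has three or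
-- five rows.
oddRectangle : ∀ a b → 1 ℕ.≤ a → a ℕ.≤ b → MagicRectangle (suc (a ℕ.+ a)) (suc (b ℕ.+ b))
oddRectangle 1 1 _ _ = rectangle₃ₓ₃
oddRectangle 1 2 _ _ = rectangle₃ₓ₅
oddRectangle 2 2 _ _ = rectangle₅ₓ₅
oddRectangle (suc (suc (suc _))) 1 _ (s≤s ())
oddRectangle (suc (suc (suc _))) 2 _ (s≤s (s≤s ()))
oddRectangle (suc (suc _)) 1 _ (s≤s ())
oddRectangle a b@(suc (suc (suc _))) 1≤a a≤b with halve a
... | M , inj₂ refl = subst (λ p → MagicRectangle p (suc (b ℕ.+ b))) (count M) (rectangle-4M+3 M (subst (ℕ._≤ b) (half M) a≤b) (s≤s (s≤s (s≤s z≤n))))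
  where
  count : ∀ M → 4 ℕ.* M ℕ.+ 3 ≡ suc (suc (M ℕ.+ M) ℕ.+ suc (M ℕ.+ M))
  count = ℕR.solve-∀
  half : ∀ M → suc (M ℕ.+ M) ≡ 1 ℕ.+ 2 ℕ.* M
  half = ℕR.solve-∀
... | suc M , inj₁ refl = subst (λ p → MagicRectangle p (suc (b ℕ.+ b))) (count M)
    (rectangle-4M+5 M (ℕP.≤-trans (ℕP.n≤1+n _) (subst (ℕ._≤ b) (half M) a≤b)) (s≤s (s≤s (s≤s z≤n))))
  where
  count : ∀ M → 4 ℕ.* M ℕ.+ 5 ≡ suc ((suc M ℕ.+ suc M) ℕ.+ (suc M ℕ.+ suc M))
  count = ℕR.solve-∀
  half : ∀ M → suc M ℕ.+ suc M ≡ 2 ℕ.+ 2 ℕ.* M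
  half = ℕR.solve-∀

quarter : ∀ M → 4 ℕ.* M ≡ (M ℕ.+ M) ℕ.+ (M ℕ.+ M)
quarter = ℕR.solve-∀

-- A side divisible by 4 can serve as the number of rows and needs no base. Only when both sides are
-- 2 modulo 4 do the six rows come in.
evenRectangle : ∀ a b → 2 ℕ.≤ a → 2 ℕ.≤ b → MagicRectangle (a ℕ.+ a) (b ℕ.+ b)
evenRectangle a b 2≤a 2≤b with halve a | halve b
... | M , inj₁ refl | _ = subst (λ p → MagicRectangle p (b ℕ.+ b)) (quarter M) (rectangle-4M M b)
... | _ | M , inj₁ refl = transpose (subst (λ p → MagicRectangle p (a ℕ.+ a)) (quarter M) (rectangle-4M M a))
... | zero , inj₂ refl | _ = contradiction 2≤a λ { (s≤s ()) }
... | _ | zero , inj₂ refl = contradiction 2≤b λ { (s≤s ()) }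
... | suc M , inj₂ refl | suc t , inj₂ refl =
  subst₂ MagicRectangle (count M) (cong (λ b → b ℕ.+ b) (half t)) (rectangle-4M+6 M t)
  where
  count : ∀ M → 4 ℕ.* M ℕ.+ 6 ≡ suc (suc M ℕ.+ suc M) ℕ.+ suc (suc M ℕ.+ suc M)
  count = ℕR.solve-∀
  half : ∀ t → 3 ℕ.+ 2 ℕ.* t ≡ suc (suc t ℕ.+ suc t)
  half = ℕR.solve-∀

half-≥2 : ∀ {a} → 3 ℕ.≤ a ℕ.+ a → 2 ℕ.≤ a
half-≥2 {suc zero}    (s≤s (s≤s ()))
half-≥2 {suc (suc _)} _ = s≤s (s≤s z≤n)

half-≥1 : ∀ {a} → 3 ℕ.≤ suc (a ℕ.+ a) → 1 ℕ.≤ a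
half-≥1 {zero}  (s≤s ())
half-≥1 {suc _} _ = s≤s z≤n

magicRectangle : ∀ p q → 3 ℕ.≤ p → 3 ℕ.≤ q → p ℕ.% 2 ≡ q ℕ.% 2 → MagicRectangle p q
magicRectangle p q 3≤p 3≤q parity with halve p | halve q
... | a , inj₁ refl | b , inj₁ refl = evenRectangle a b (half-≥2 3≤p) (half-≥2 3≤q)
... | a , inj₂ refl | b , inj₂ refl with ℕP.≤-total a b
...   | inj₁ a≤b = oddRectangle a b (half-≥1 3≤p) a≤b
...   | inj₂ b≤a = transpose (oddRectangle b a (half-≥1 3≤q) b≤a)
magicRectangle p q _ _ parity | a , inj₁ refl | b , inj₂ refl = contradiction (trans (sym (double-%2 a)) (trans parity (suc-double-%2 b))) λ ()
magicRectangle p q _ _ parity | a , inj₂ refl | b , inj₁ refl = contradiction (trans (sym (suc-double-%2 a)) (trans parity (double-%2 b))) λ ()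

-- Sums over edges

sum-tabulate : ∀ {n} (f : Fin n → ℕ) → sum (tabulate f) ≡ Σℕ.sum f
sum-tabulate {zero}  f = refl
sum-tabulate {suc n} f = cong (f zero ℕ.+_) (sum-tabulate (f ∘ suc))

sum-allFin : ∀ {n} (f : Fin n → ℕ) → sum (map f (allFin n)) ≡ Σℕ.sum f
sum-allFin f = trans (cong sum (ListP.map-tabulate id f)) (sum-tabulate f)

sum-lookup : ∀ {A : Set} (h : A → ℕ) (xs : List A) → Σℕ.sum (λ k → h (lookup xs k)) ≡ sum (map h xs)
sum-lookup h []       = refl
sum-lookup h (x ∷ xs) = cong (h x ℕ.+_) (sum-lookup h xs)

sum-concatMap : ∀ {A B : Set} (h : B → ℕ) (f : A → List B) (xs : List A) →
                sum (map h (concatMap f xs)) ≡ sum (map (λ x → sum (map h (f x))) xs)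
sum-concatMap h f []       = refl
sum-concatMap h f (x ∷ xs) = begin
  sum (map h (f x List.++ concatMap f xs))               ≡⟨ cong sum (ListP.map-++ h (f x) _) ⟩
  sum (map h (f x) List.++ map h (concatMap f xs))       ≡⟨ ListAction.sum-++ (map h (f x)) _ ⟩
  sum (map h (f x)) ℕ.+ sum (map h (concatMap f xs))     ≡⟨ cong (sum (map h (f x)) ℕ.+_) (sum-concatMap h f xs) ⟩
  sum (map h (f x)) ℕ.+ sum (map (λ x → sum (map h (f x))) xs) ∎
  where open ≡-Reasoning

-- The key recovers the block an element comes from, so different blocks are disjoint.
concatMap-unique : ∀ {A B : Set} {f : A → List B} (key : B → A) → (∀ x {y} → y ∈ f x → key y ≡ x) →
                   (∀ x → Unique (f x)) → ∀ {xs} → Unique xs → Unique (concatMap f xs)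
concatMap-unique key key-f unique-f []        = []
concatMap-unique {f = f} key key-f unique-f {x ∷ xs} (x∉ ∷ u) =
  UniqueP.++⁺ (unique-f x) (concatMap-unique key key-f unique-f u) λ (y∈fx , y∈rest) →
    let x′ , x′∈ , y∈fx′ = find (∈P.∈-concatMap⁻ f y∈rest)
    in All.lookup x∉ x′∈ (trans (sym (key-f x y∈fx)) (key-f x′ y∈fx′))

-- Both bounds on the number of colors are comparisons of this kind between lists of vertex sums.
unique-⊆⇒length≤ : ∀ {A : Set} {xs ys : List A} → Unique xs → (∀ {z} → z ∈ xs → z ∈ ys) → length xs ℕ.≤ length ys
unique-⊆⇒length≤ {xs = xs} {ys} u sub = FP.injective⇒≤ {f = position} λ {i} {j} eq →
  lookup-injective u (trans (located i) (trans (cong (lookup ys) eq) (sym (located j))))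
  where
  position : Fin (length xs) → Fin (length ys)
  position k = Any.index (sub (∈P.∈-lookup k))
  located : ∀ k → lookup xs k ≡ lookup ys (position k)
  located k = AnyP.lookup-index (sub (∈P.∈-lookup k))

kronecker : ∀ {n} → Fin n → Fin n → ℕ → ℕ
kronecker u i x = if does (u ≟ i) then x else 0

sum-kronecker : ∀ {n} (u : Fin n) (f : Fin n → ℕ) → Σℕ.sum (λ i → kronecker u i (f i)) ≡ f u
sum-kronecker {suc n} zero    f = trans (cong (f zero ℕ.+_) (Σℕ.sum-replicate-zero n)) (ℕP.+-identityʳ (f zero))
sum-kronecker {suc n} (suc u) f = sum-kronecker u (f ∘ suc)

sum-if : ∀ {n} (b : Bool) (f : Fin n → ℕ) → Σℕ.sum (λ i → if b then f i else 0) ≡ (if b then Σℕ.sum f else 0)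
sum-if     true  f = refl
sum-if {n} false f = Σℕ.sum-replicate-zero n

module _ (G : Graph) where

  private N = Graph.n G

  isEdge : Fin N → Fin N → Bool
  isEdge i j = (toℕ i <ᵇ toℕ j) ∧ adj G i j

  isEdge-lt : ∀ i j → T (isEdge i j) → toℕ i ℕ.< toℕ j
  isEdge-lt i j t = ℕP.<ᵇ⇒< _ _ (proj₁ (Bool.T-∧ .Equivalence.to t))

  isEdge-adj : ∀ i j → T (isEdge i j) → T (adj G i j)
  isEdge-adj i j t = proj₂ (Bool.T-∧ {toℕ i <ᵇ toℕ j} .Equivalence.to t)

  isEdge-intro : ∀ {i j} → toℕ i ℕ.< toℕ j → T (adj G i j) → T (isEdge i j)
  isEdge-intro i<j a = Bool.T-∧ .Equivalence.from (ℕP.<⇒<ᵇ i<j , a)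

  private
    cell : Fin N → Fin N → List (Fin N × Fin N)
    cell i j = if isEdge i j then List.[ (i , j) ] else []

    ∈-cell⁻ : ∀ i j {e} → e ∈ cell i j → e ≡ (i , j) × T (isEdge i j)
    ∈-cell⁻ i j e∈ with isEdge i j
    ∈-cell⁻ i j (here eq) | true = eq , _
    ∈-cell⁻ i j ()        | false

    cell-unique : ∀ i j → Unique (cell i j)
    cell-unique i j with isEdge i j
    ... | true  = [] ∷ []
    ... | false = []

    row : Fin N → List (Fin N × Fin N)
    row i = concatMap (cell i) (allFin N)

    ∈-row⁻ : ∀ i {e} → e ∈ row i → ∃ λ j → e ≡ (i , j) × T (isEdge i j)
    ∈-row⁻ i e∈ = let j , _ , e∈cell = find (∈P.∈-concatMap⁻ (cell i) {xs = allFin N} e∈) in j , ∈-cell⁻ i j e∈cell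

  edges-unique : Unique (edges G)
  edges-unique = concatMap-unique proj₁ (λ i e∈ → let _ , eq , _ = ∈-row⁻ i e∈ in cong proj₁ eq)
    (λ i → concatMap-unique proj₂ (λ j e∈ → cong proj₂ (proj₁ (∈-cell⁻ i j e∈))) (cell-unique i) (UniqueP.allFin⁺ N))
    (UniqueP.allFin⁺ N)

  edge-injective : Injective _≡_ _≡_ (edge G)
  edge-injective = lookup-injective edges-unique

  edge-isEdge : ∀ k → T (uncurry isEdge (edge G k))
  edge-isEdge k =
    let i , _ , e∈row = find (∈P.∈-concatMap⁻ row {xs = allFin N} (∈P.∈-lookup {xs = edges G} k))
        j , eq , t = ∈-row⁻ i e∈row
    in subst (T ∘ uncurry isEdge) (sym eq) t

  edge-surjective : ∀ {i j} → T (isEdge i j) → ∃ λ k → edge G k ≡ (i , j)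
  edge-surjective {i} {j} t = Any.index e∈ , sym (AnyP.lookup-index e∈)
    where
    e∈cell : (i , j) ∈ cell i j
    e∈cell with isEdge i j
    ... | true = here refl
    e∈ : (i , j) ∈ edges G
    e∈ = ∈P.∈-concatMap⁺ row (lose (∈P.∈-allFin i) (∈P.∈-concatMap⁺ (cell i) (lose (∈P.∈-allFin j) e∈cell)))

  edges-sum : ∀ (h : Fin N × Fin N → ℕ) →
    Σℕ.sum (λ k → h (edge G k)) ≡ Σℕ.sum (λ i → Σℕ.sum (λ j → if isEdge i j then h (i , j) else 0))
  edges-sum h = begin
    Σℕ.sum (λ k → h (edge G k))                        ≡⟨ sum-lookup h (edges G) ⟩
    sum (map h (concatMap row (allFin N)))             ≡⟨ sum-concatMap h row (allFin N) ⟩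
    sum (map (λ i → sum (map h (row i))) (allFin N))   ≡⟨ sum-allFin (λ i → sum (map h (row i))) ⟩
    Σℕ.sum (λ i → sum (map h (row i)))                 ≡⟨ Σℕ.sum-cong-≗ (λ i →
      trans (sum-concatMap h (cell i) (allFin N)) (trans (sum-allFin (λ j → sum (map h (cell i j)))) (Σℕ.sum-cong-≗ (cell-sum i)))) ⟩
    Σℕ.sum (λ i → Σℕ.sum (λ j → if isEdge i j then h (i , j) else 0)) ∎
    where
    open ≡-Reasoning
    cell-sum : ∀ i j → sum (map h (cell i j)) ≡ (if isEdge i j then h (i , j) else 0)
    cell-sum i j with isEdge i j
    ... | true  = ℕP.+-identityʳ (h (i , j))
    ... | false = refl

  -- Each edge is listed once, smaller end first, so a symmetric weight enters the sums as a
  -- strictly upper triangular matrix.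
  directed : (Fin N → Fin N → ℕ) → Fin N → Fin N → ℕ
  directed W i j = if isEdge i j then W i j else 0

  <ᵇ-true : ∀ {a b} → a ℕ.< b → (a <ᵇ b) ≡ true
  <ᵇ-true a<b = Bool.T-≡ .Equivalence.to (ℕP.<⇒<ᵇ a<b)

  <ᵇ-false : ∀ {a b} → ¬ (a ℕ.< b) → (a <ᵇ b) ≡ false
  <ᵇ-false {a} {b} a≮b = Bool.¬-not (λ eq → a≮b (ℕP.<ᵇ⇒< a b (Bool.T-≡ .Equivalence.from eq)))

  undirected : ∀ (W : Fin N → Fin N → ℕ) → (∀ i j → W i j ≡ W j i) → ∀ u v →
    directed W u v ℕ.+ directed W v u ≡ (if adj G u v then W u v else 0)
  undirected W W-sym u v with ℕP.<-cmp (toℕ u) (toℕ v)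
  ... | tri< u<v _ v≮u rewrite <ᵇ-true u<v | <ᵇ-false v≮u = ℕP.+-identityʳ _
  ... | tri> u≮v _ v<u rewrite <ᵇ-true v<u | <ᵇ-false u≮v | Graph.sym G u v | W-sym u v = refl
  ... | tri≈ u≮v u≡v v≮u with FP.toℕ-injective u≡v
  ...   | refl rewrite <ᵇ-false u≮v | Graph.irrefl G u = refl

  -- The edges at `u` form row `u` and column `u` of the triangular matrix, which meet only on the
  -- empty diagonal. Together they are row `u` of the symmetric matrix.
  incidence-sum : ∀ (W : Fin N → Fin N → ℕ) → (∀ i j → W i j ≡ W j i) → ∀ u →
    Σℕ.sum (λ k → if incident u (edge G k) then uncurry W (edge G k) else 0)
      ≡ Σℕ.sum (λ v → if adj G u v then W u v else 0)
  incidence-sum W W-sym u = begin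
    Σℕ.sum (λ k → if incident u (edge G k) then uncurry W (edge G k) else 0)
      ≡⟨ edges-sum (λ e → if incident u e then uncurry W e else 0) ⟩
    Σℕ.sum (λ i → Σℕ.sum (λ j → if isEdge i j then (if incident u (i , j) then W i j else 0) else 0))
      ≡⟨ Σℕ.sum-cong-≗ (λ i → trans (Σℕ.sum-cong-≗ (endpoints i))
           (Σℕ.∑-distrib-+ (λ j → kronecker u i (directed W i j)) (λ j → kronecker u j (directed W i j)))) ⟩
    Σℕ.sum (λ i → Σℕ.sum (λ j → kronecker u i (directed W i j)) ℕ.+ Σℕ.sum (λ j → kronecker u j (directed W i j)))
      ≡⟨ Σℕ.sum-cong-≗ (λ i → cong₂ ℕ._+_ (sum-if (does (u ≟ i)) (directed W i)) (sum-kronecker u (directed W i))) ⟩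
    Σℕ.sum (λ i → kronecker u i (Σℕ.sum (directed W i)) ℕ.+ directed W i u)
      ≡⟨ Σℕ.∑-distrib-+ (λ i → kronecker u i (Σℕ.sum (directed W i))) (λ i → directed W i u) ⟩
    Σℕ.sum (λ i → kronecker u i (Σℕ.sum (directed W i))) ℕ.+ Σℕ.sum (λ i → directed W i u)
      ≡⟨ cong (ℕ._+ Σℕ.sum (λ i → directed W i u)) (sum-kronecker u (λ i → Σℕ.sum (directed W i))) ⟩
    Σℕ.sum (directed W u) ℕ.+ Σℕ.sum (λ v → directed W v u)
      ≡⟨ Σℕ.∑-distrib-+ (directed W u) (λ v → directed W v u) ⟨
    Σℕ.sum (λ v → directed W u v ℕ.+ directed W v u)
      ≡⟨ Σℕ.sum-cong-≗ (undirected W W-sym u) ⟩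
    Σℕ.sum (λ v → if adj G u v then W u v else 0) ∎
    where
    open ≡-Reasoning
    endpoints : ∀ i j → (if isEdge i j then (if incident u (i , j) then W i j else 0) else 0)
                          ≡ kronecker u i (directed W i j) ℕ.+ kronecker u j (directed W i j)
    endpoints i j with u ≟ i | u ≟ j
    ... | yes refl | yes refl rewrite <ᵇ-false (ℕP.<-irrefl (refl {x = toℕ u})) = refl
    ... | yes _ | no _ = sym (ℕP.+-identityʳ _)
    ... | no _ | yes _ = refl
    ... | no _ | no _ with isEdge i j
    ...   | true  = refl
    ...   | false = refl

  handshake : 2 ℕ.* size G ≡ Σℕ.sum (degree G)
  handshake = begin
    2 ℕ.* size G                                        ≡⟨ cong (size G ℕ.+_) (ℕP.+-identityʳ (size G)) ⟩
    size G ℕ.+ size G                                   ≡⟨ cong (λ s → s ℕ.+ s) count ⟩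
    s ℕ.+ s                                             ≡⟨ cong (s ℕ.+_) (Σℕ.∑-comm (directed one)) ⟩
    s ℕ.+ Σℕ.sum (λ u → Σℕ.sum (λ v → directed one v u)) ≡⟨ Σℕ.∑-distrib-+ (λ u → Σℕ.sum (directed one u)) (λ u → Σℕ.sum (λ v → directed one v u)) ⟨
    Σℕ.sum (λ u → Σℕ.sum (directed one u) ℕ.+ Σℕ.sum (λ v → directed one v u))
      ≡⟨ Σℕ.sum-cong-≗ (λ u → trans (sym (Σℕ.∑-distrib-+ (directed one u) (λ v → directed one v u)))
                                    (trans (Σℕ.sum-cong-≗ (undirected one (λ _ _ → refl) u)) (sym (sum-allFin (λ v → if adj G u v then 1 else 0))))) ⟩
    Σℕ.sum (degree G) ∎
    where
    open ≡-Reasoning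
    one : Fin N → Fin N → ℕ
    one _ _ = 1
    s = Σℕ.sum (λ u → Σℕ.sum (directed one u))
    ones : ∀ n → Σℕ.sum {n} (λ _ → 1) ≡ n
    ones zero    = refl
    ones (suc n) = cong suc (ones n)
    count : size G ≡ s
    count = trans (sym (ones (size G))) (edges-sum (λ _ → 1))

  -- Trades edge indices for neighbours: a sum over neighbours splits along the two sides of a join,
  -- one over edge indices does not.
  fplus-weight : ∀ (σ : Labeling G) (W : Fin N → Fin N → ℕ) → (∀ i j → W i j ≡ W j i) →
    (∀ k → label G σ k ≡ uncurry W (edge G k)) → ∀ u →
    fplus G σ u ≡ Σℕ.sum (λ v → if adj G u v then W u v else 0)
  fplus-weight σ W W-sym W-label u = begin
    fplus G σ u                                                        ≡⟨ sum-allFin (λ k → if incident u (edge G k) then label G σ k else 0) ⟩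
    Σℕ.sum (λ k → if incident u (edge G k) then label G σ k else 0)
      ≡⟨ Σℕ.sum-cong-≗ (λ k → cong (λ w → if incident u (edge G k) then w else 0) (W-label k)) ⟩
    Σℕ.sum (λ k → if incident u (edge G k) then uncurry W (edge G k) else 0) ≡⟨ incidence-sum W W-sym u ⟩
    Σℕ.sum (λ v → if adj G u v then W u v else 0)                      ∎
    where open ≡-Reasoning

  module _ (σ : Labeling G) where

    -- Zero off the listed orientation of an edge, so symmetrizing yields a weight on unordered
    -- pairs without choosing an orientation.
    arcLabel : Fin N → Fin N → ℕ
    arcLabel i j with FP.any? (λ k → ×P.≡-dec _≟_ _≟_ (edge G k) (i , j))
    ... | yes (k , _) = label G σ k
    ... | no _        = 0

    arcLabel-edge : ∀ k → uncurry arcLabel (edge G k) ≡ label G σ k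
    arcLabel-edge k with FP.any? (λ k′ → ×P.≡-dec _≟_ _≟_ (edge G k′) (edge G k))
    ... | yes (k′ , eq) = cong (label G σ) (edge-injective eq)
    ... | no none       = contradiction (k , refl) none

    arcLabel-reversed : ∀ k → arcLabel (proj₂ (edge G k)) (proj₁ (edge G k)) ≡ 0
    arcLabel-reversed k with FP.any? (λ k′ → ×P.≡-dec _≟_ _≟_ (edge G k′) (proj₂ (edge G k) , proj₁ (edge G k)))
    ... | no _ = refl
    ... | yes (k′ , eq) = contradiction (isEdge-lt _ _ (edge-isEdge k))
                            (ℕP.<-asym (subst (λ e → toℕ (proj₁ e) ℕ.< toℕ (proj₂ e)) eq (isEdge-lt _ _ (edge-isEdge k′))))

    weight : Fin N → Fin N → ℕ
    weight i j = arcLabel i j ℕ.+ arcLabel j i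

    weight-sym : ∀ i j → weight i j ≡ weight j i
    weight-sym i j = ℕP.+-comm (arcLabel i j) (arcLabel j i)

    weight-edge : ∀ k → label G σ k ≡ uncurry weight (edge G k)
    weight-edge k = sym (trans (cong₂ ℕ._+_ (arcLabel-edge k) (arcLabel-reversed k)) (ℕP.+-identityʳ _))

-- Labeling the join

sum-suc : ∀ {n} (f : Fin n → ℕ) → Σℕ.sum (λ i → suc (f i)) ≡ n + Σℕ.sum f
sum-suc {zero}  f = refl
sum-suc {suc n} f = cong suc (trans (cong (f zero ℕ.+_) (sum-suc (f ∘ suc))) (swap (f zero) n (Σℕ.sum (f ∘ suc))))
  where
  swap : ∀ a b c → a + (b + c) ≡ b + (a + c)
  swap = ℕR.solve-∀

sum-if-+ : ∀ c {n} (b : Fin n → Bool) (f : Fin n → ℕ) →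
  Σℕ.sum (λ i → if b i then c + f i else 0) ≡ Σℕ.sum (λ i → if b i then 1 else 0) * c + Σℕ.sum (λ i → if b i then f i else 0)
sum-if-+ c {zero}  b f = refl
sum-if-+ c {suc n} b f rewrite sum-if-+ c (b ∘ suc) (f ∘ suc) with b zero
... | true  = regroup c (f zero) (Σℕ.sum (λ i → if b (suc i) then 1 else 0)) (Σℕ.sum (λ i → if b (suc i) then f (suc i) else 0))
  where
  regroup : ∀ c x s t → (c + x) + (s * c + t) ≡ (1 + s) * c + (x + t)
  regroup = ℕR.solve-∀
... | false = refl

sum-const : ∀ n c → Σℕ.sum {n} (λ _ → c) ≡ n * c
sum-const zero    c = refl
sum-const (suc n) c = cong (c ℕ.+_) (sum-const n c)

join-injective : ∀ m n {s t} → Fin.join m n s ≡ Fin.join m n t → s ≡ t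
join-injective m n {s} {t} eq = trans (sym (FP.splitAt-join m n s)) (trans (cong (splitAt m) eq) (FP.splitAt-join m n t))

permutation-injective : ∀ {n} (π : Permutation′ n) → Injective _≡_ _≡_ (π ⟨$⟩ʳ_)
permutation-injective π eq = trans (sym (Perm.inverseˡ π)) (trans (cong (π Perm.⟨$⟩ˡ_) eq) (Perm.inverseˡ π))

module JoinLabeling (G₁ G₂ : Graph) (σ₁ : Labeling G₁) (σ₂ : Labeling G₂) (R : MagicRectangle (Graph.n G₁) (Graph.n G₂)) where

  open MagicRectangle R

  G : Graph
  G = join G₁ G₂

  n₁ n₂ s₁ s₂ P : ℕ
  n₁ = Graph.n G₁
  n₂ = Graph.n G₂
  s₁ = size G₁
  s₂ = size G₂
  P  = n₁ * n₂

  -- Names the edges of the join by origin, independently of their order in `edges G`.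
  Code : Set
  Code = (Fin n₁ × Fin n₂) ⊎ (Fin s₁ ⊎ Fin s₂)

  endpoints : Code → Fin (n₁ + n₂) × Fin (n₁ + n₂)
  endpoints (inj₁ (x , y))  = x ↑ˡ n₂ , n₁ ↑ʳ y
  endpoints (inj₂ (inj₁ k)) = proj₁ (edge G₁ k) ↑ˡ n₂ , proj₂ (edge G₁ k) ↑ˡ n₂
  endpoints (inj₂ (inj₂ k)) = n₁ ↑ʳ proj₁ (edge G₂ k) , n₁ ↑ʳ proj₂ (edge G₂ k)

  number : Code → Fin (P + (s₁ + s₂))
  number = Fin.join P (s₁ + s₂) ∘ Sum.map (uncurry entry) (Fin.join s₁ s₂ ∘ Sum.map (σ₁ ⟨$⟩ʳ_) (σ₂ ⟨$⟩ʳ_))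

  number-injective : Injective _≡_ _≡_ number
  number-injective {c} {c′} eq = outer c c′ (join-injective P (s₁ + s₂) eq)
    where
    inner : ∀ (c c′ : Fin s₁ ⊎ Fin s₂) → Sum.map (σ₁ ⟨$⟩ʳ_) (σ₂ ⟨$⟩ʳ_) c ≡ Sum.map (σ₁ ⟨$⟩ʳ_) (σ₂ ⟨$⟩ʳ_) c′ → c ≡ c′
    inner (inj₁ _) (inj₁ _) eq = cong inj₁ (permutation-injective σ₁ (SumP.inj₁-injective eq))
    inner (inj₂ _) (inj₂ _) eq = cong inj₂ (permutation-injective σ₂ (SumP.inj₂-injective eq))
    outer : ∀ c c′ → Sum.map (uncurry entry) (Fin.join s₁ s₂ ∘ Sum.map (σ₁ ⟨$⟩ʳ_) (σ₂ ⟨$⟩ʳ_)) c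
                       ≡ Sum.map (uncurry entry) (Fin.join s₁ s₂ ∘ Sum.map (σ₁ ⟨$⟩ʳ_) (σ₂ ⟨$⟩ʳ_)) c′ → c ≡ c′
    outer (inj₁ _) (inj₁ _) eq with injective (SumP.inj₁-injective eq)
    ... | refl , refl = refl
    outer (inj₂ c) (inj₂ c′) eq = cong inj₂ (inner c c′ (join-injective s₁ s₂ (SumP.inj₂-injective eq)))

  private
    classify : ∀ s t → toℕ (Fin.join n₁ n₂ s) ℕ.< toℕ (Fin.join n₁ n₂ t) → T (joinAdj′ (adj G₁) (adj G₂) s t) →
               ∃ λ c → endpoints c ≡ (Fin.join n₁ n₂ s , Fin.join n₁ n₂ t)
    classify (inj₁ x) (inj₁ y) lt a =
      let k , eq = edge-surjective G₁ (isEdge-intro G₁ (subst₂ ℕ._<_ (FP.toℕ-↑ˡ x n₂) (FP.toℕ-↑ˡ y n₂) lt) a)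
      in inj₂ (inj₁ k) , cong (λ e → proj₁ e ↑ˡ n₂ , proj₂ e ↑ˡ n₂) eq
    classify (inj₁ x) (inj₂ y) lt a = inj₁ (x , y) , refl
    -- Vertices of `G₁` precede those of `G₂`, so a cross edge is always listed with its `G₁` end
    -- first.
    classify (inj₂ y) (inj₁ x) lt a = contradiction (subst₂ ℕ._<_ (FP.toℕ-↑ʳ n₁ y) (FP.toℕ-↑ˡ x n₂) lt)
      (ℕP.≤⇒≯ (ℕP.≤-trans (ℕP.<⇒≤ (FP.toℕ<n x)) (ℕP.m≤m+n n₁ (toℕ y))))
    classify (inj₂ x) (inj₂ y) lt a =
      let k , eq = edge-surjective G₂ (isEdge-intro G₂ (ℕP.+-cancelˡ-< n₁ _ _ (subst₂ ℕ._<_ (FP.toℕ-↑ʳ n₁ x) (FP.toℕ-↑ʳ n₁ y) lt)) a)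
      in inj₂ (inj₂ k) , cong (λ e → n₁ ↑ʳ proj₁ e , n₁ ↑ʳ proj₂ e) eq

    encode : ∀ k → ∃ λ c → endpoints c ≡ edge G k
    encode k = c , trans eq (cong₂ _,_ (FP.join-splitAt n₁ n₂ i) (FP.join-splitAt n₁ n₂ j))
      where
      i = proj₁ (edge G k)
      j = proj₂ (edge G k)
      found = classify (splitAt n₁ i) (splitAt n₁ j)
        (subst₂ ℕ._<_ (cong toℕ (sym (FP.join-splitAt n₁ n₂ i))) (cong toℕ (sym (FP.join-splitAt n₁ n₂ j))) (isEdge-lt G i j (edge-isEdge G k)))
        (isEdge-adj G i j (edge-isEdge G k))
      c = proj₁ found
      eq = proj₂ found

  code : Fin (size G) → Code
  code k = proj₁ (encode k)

  code-endpoints : ∀ k → endpoints (code k) ≡ edge G k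
  code-endpoints k = proj₂ (encode k)

  code-injective : Injective _≡_ _≡_ code
  code-injective {k} {k′} eq = edge-injective G (trans (sym (code-endpoints k)) (trans (cong endpoints eq) (code-endpoints k′)))

  join-sum : ∀ (h : Fin n₁ ⊎ Fin n₂ → ℕ) → Σℕ.sum (λ v → h (splitAt n₁ v)) ≡ Σℕ.sum (h ∘ inj₁) + Σℕ.sum (h ∘ inj₂)
  join-sum = sum-splitAt ℕP.+-0-commutativeMonoid n₁

  -- Obtained by counting degrees. With it, an injective numbering of the edges is already a
  -- permutation, and no inverse of `code` has to be built.
  size-join : P + (s₁ + s₂) ≡ size G
  size-join = ℕP.*-cancelˡ-≡ _ _ 2 (begin
    2 * (P + (s₁ + s₂))                            ≡⟨ regroup n₁ n₂ s₁ s₂ ⟩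
    (2 * s₁ + n₁ * n₂) + (n₂ * n₁ + 2 * s₂)        ≡⟨ cong₂ (λ a b → (a + n₁ * n₂) + (n₂ * n₁ + b)) (handshake G₁) (handshake G₂) ⟩
    (Σℕ.sum (degree G₁) + n₁ * n₂) + (n₂ * n₁ + Σℕ.sum (degree G₂))
      ≡⟨ cong₂ (λ a b → (Σℕ.sum (degree G₁) + a) + (b + Σℕ.sum (degree G₂))) (sum-const n₁ n₂) (sum-const n₂ n₁) ⟨
    (Σℕ.sum (degree G₁) + Σℕ.sum {n₁} (λ _ → n₂)) + (Σℕ.sum {n₂} (λ _ → n₁) + Σℕ.sum (degree G₂))
      ≡⟨ cong₂ _+_ (Σℕ.∑-distrib-+ (degree G₁) (λ _ → n₂)) (Σℕ.∑-distrib-+ (λ _ → n₁) (degree G₂)) ⟨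
    Σℕ.sum (λ x → degree G₁ x + n₂) + Σℕ.sum (λ y → n₁ + degree G₂ y) ≡⟨ join-sum degreeJ ⟨
    Σℕ.sum (λ v → degreeJ (splitAt n₁ v))         ≡⟨ Σℕ.sum-cong-≗ degree-join ⟨
    Σℕ.sum (degree G)                             ≡⟨ handshake G ⟨
    2 * size G                                    ∎)
    where
    open ≡-Reasoning
    regroup : ∀ a b c d → 2 * (a * b + (c + d)) ≡ (2 * c + a * b) + (b * a + 2 * d)
    regroup = ℕR.solve-∀
    degreeJ : Fin n₁ ⊎ Fin n₂ → ℕ
    degreeJ (inj₁ x) = degree G₁ x + n₂
    degreeJ (inj₂ y) = n₁ + degree G₂ y
    count : ∀ s → Σℕ.sum (λ v → if joinAdj′ (adj G₁) (adj G₂) s (splitAt n₁ v) then 1 else 0) ≡ degreeJ s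
    count (inj₁ x) = trans (join-sum (λ t → if joinAdj′ (adj G₁) (adj G₂) (inj₁ x) t then 1 else 0))
      (cong₂ _+_ (sym (sum-allFin (λ v → if adj G₁ x v then 1 else 0))) (trans (sum-const n₂ 1) (ℕP.*-identityʳ n₂)))
    count (inj₂ y) = trans (join-sum (λ t → if joinAdj′ (adj G₁) (adj G₂) (inj₂ y) t then 1 else 0))
      (cong₂ _+_ (trans (sum-const n₁ 1) (ℕP.*-identityʳ n₁)) (sym (sum-allFin (λ v → if adj G₂ y v then 1 else 0))))
    degree-join : ∀ v → degree G v ≡ degreeJ (splitAt n₁ v)
    degree-join v = trans (sum-allFin (λ w → if adj G v w then 1 else 0)) (count (splitAt n₁ v))

  σ : Labeling G
  σ = injective⇒permutation (λ k → cast size-join (number (code k)))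
    (λ eq → code-injective (number-injective (FP.toℕ-injective
      (trans (sym (FP.toℕ-cast size-join _)) (trans (cong toℕ eq) (FP.toℕ-cast size-join _))))))

  pairWeight : Fin n₁ ⊎ Fin n₂ → Fin n₁ ⊎ Fin n₂ → ℕ
  pairWeight (inj₁ x) (inj₁ x′) = P + weight G₁ σ₁ x x′
  pairWeight (inj₁ x) (inj₂ y)  = suc (toℕ (entry x y))
  pairWeight (inj₂ y) (inj₁ x)  = suc (toℕ (entry x y))
  pairWeight (inj₂ y) (inj₂ y′) = (P + s₁) + weight G₂ σ₂ y y′

  pairWeight-sym : ∀ s t → pairWeight s t ≡ pairWeight t s
  pairWeight-sym (inj₁ x) (inj₁ x′) = cong (P ℕ.+_) (weight-sym G₁ σ₁ x x′)
  pairWeight-sym (inj₁ x) (inj₂ y)  = refl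
  pairWeight-sym (inj₂ y) (inj₁ x)  = refl
  pairWeight-sym (inj₂ y) (inj₂ y′) = cong ((P + s₁) ℕ.+_) (weight-sym G₂ σ₂ y y′)

  joinWeight : Fin (n₁ + n₂) → Fin (n₁ + n₂) → ℕ
  joinWeight u v = pairWeight (splitAt n₁ u) (splitAt n₁ v)

  number-weight : ∀ c → suc (toℕ (number c)) ≡ uncurry joinWeight (endpoints c)
  number-weight (inj₁ (x , y))
    rewrite FP.splitAt-↑ˡ n₁ x n₂ | FP.splitAt-↑ʳ n₁ n₂ y = cong suc (FP.toℕ-↑ˡ (entry x y) (s₁ + s₂))
  number-weight (inj₂ (inj₁ k))
    rewrite FP.splitAt-↑ˡ n₁ (proj₁ (edge G₁ k)) n₂ | FP.splitAt-↑ˡ n₁ (proj₂ (edge G₁ k)) n₂ =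
    trans (cong suc (trans (FP.toℕ-↑ʳ P _) (cong (P ℕ.+_) (FP.toℕ-↑ˡ (σ₁ ⟨$⟩ʳ k) s₂))))
          (trans (sym (ℕP.+-suc P _)) (cong (P ℕ.+_) (weight-edge G₁ σ₁ k)))
  number-weight (inj₂ (inj₂ k))
    rewrite FP.splitAt-↑ʳ n₁ n₂ (proj₁ (edge G₂ k)) | FP.splitAt-↑ʳ n₁ n₂ (proj₂ (edge G₂ k)) =
    trans (cong suc (trans (FP.toℕ-↑ʳ P _) (trans (cong (P ℕ.+_) (FP.toℕ-↑ʳ s₁ (σ₂ ⟨$⟩ʳ k))) (sym (ℕP.+-assoc P s₁ _)))))
          (trans (sym (ℕP.+-suc (P + s₁) _)) (cong ((P + s₁) ℕ.+_) (weight-edge G₂ σ₂ k)))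

  label-weight : ∀ k → label G σ k ≡ uncurry joinWeight (edge G k)
  label-weight k = trans (cong suc (FP.toℕ-cast size-join (number (code k))))
    (trans (number-weight (code k)) (cong (uncurry joinWeight) (code-endpoints k)))

  vertexSum : Fin n₁ ⊎ Fin n₂ → ℕ
  vertexSum s = Σℕ.sum (λ v → if joinAdj′ (adj G₁) (adj G₂) s (splitAt n₁ v) then pairWeight s (splitAt n₁ v) else 0)

  fplus-join : ∀ u → fplus G σ u ≡ vertexSum (splitAt n₁ u)
  fplus-join = fplus-weight G σ joinWeight (λ u v → pairWeight-sym (splitAt n₁ u) (splitAt n₁ v)) label-weight

  module _ {r₁ r₂ : ℕ} (regular₁ : Regular G₁ r₁) (regular₂ : Regular G₂ r₂) where

    -- Twice the amounts by which the vertex sums of G₁ and of G₂ grow in the join.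
    shift₁ shift₂ : ℕ
    shift₁ = 2 * (r₁ * P) + n₂ * (P + 1)
    shift₂ = 2 * (r₂ * (P + s₁)) + n₁ * (P + 1)

    twice-vertexSum : Fin n₁ ⊎ Fin n₂ → ℕ
    twice-vertexSum (inj₁ x) = 2 * fplus G₁ σ₁ x + shift₁
    twice-vertexSum (inj₂ y) = 2 * fplus G₂ σ₂ y + shift₂

    -- A vertex of `G₁` has its `r₁` old labels raised by `P` each and gains a row of the rectangle,
    -- of sum n₂(P + 1)/2; on the other side the raise is P + s₁ and a column is gained. Doubling
    -- avoids the halves.
    vertexSum-value : ∀ s → 2 * vertexSum s ≡ twice-vertexSum s
    vertexSum-value (inj₁ x) = begin
      2 * vertexSum (inj₁ x)
        ≡⟨ cong (2 *_) (join-sum (λ t → if joinAdj′ (adj G₁) (adj G₂) (inj₁ x) t then pairWeight (inj₁ x) t else 0)) ⟩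
      2 * (Σℕ.sum (λ x′ → if adj G₁ x x′ then P + weight G₁ σ₁ x x′ else 0) + Σℕ.sum (λ y → suc (toℕ (entry x y))))
        ≡⟨ cong₂ (λ a b → 2 * (a + b)) inside (sum-suc (λ y → toℕ (entry x y))) ⟩
      2 * ((r₁ * P + fplus G₁ σ₁ x) + (n₂ + e))            ≡⟨ regroup (r₁ * P) (fplus G₁ σ₁ x) n₂ e ⟩
      2 * fplus G₁ σ₁ x + (2 * (r₁ * P) + ((n₂ + 2 * e) + n₂)) ≡⟨ cong (λ z → 2 * fplus G₁ σ₁ x + (2 * (r₁ * P) + (z + n₂))) (row-sum x) ⟩
      2 * fplus G₁ σ₁ x + (2 * (r₁ * P) + (n₂ * P + n₂))   ≡⟨ cong (λ z → 2 * fplus G₁ σ₁ x + (2 * (r₁ * P) + z)) (factor n₂ P) ⟩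
      2 * fplus G₁ σ₁ x + shift₁                           ∎
      where
      open ≡-Reasoning
      e = Σℕ.sum (λ y → toℕ (entry x y))
      inside : Σℕ.sum (λ x′ → if adj G₁ x x′ then P + weight G₁ σ₁ x x′ else 0) ≡ r₁ * P + fplus G₁ σ₁ x
      inside = trans (sum-if-+ P (adj G₁ x) (weight G₁ σ₁ x))
        (cong₂ (λ d f → d * P + f) (trans (sym (sum-allFin (λ v → if adj G₁ x v then 1 else 0))) (regular₁ x))
          (sym (fplus-weight G₁ σ₁ (weight G₁ σ₁) (weight-sym G₁ σ₁) (weight-edge G₁ σ₁) x)))
      regroup : ∀ a f n e → 2 * ((a + f) + (n + e)) ≡ 2 * f + (2 * a + ((n + 2 * e) + n))
      regroup = ℕR.solve-∀
      factor : ∀ n P → n * P + n ≡ n * (P + 1)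
      factor = ℕR.solve-∀
    vertexSum-value (inj₂ y) = begin
      2 * vertexSum (inj₂ y)
        ≡⟨ cong (2 *_) (join-sum (λ t → if joinAdj′ (adj G₁) (adj G₂) (inj₂ y) t then pairWeight (inj₂ y) t else 0)) ⟩
      2 * (Σℕ.sum (λ x → suc (toℕ (entry x y))) + Σℕ.sum (λ y′ → if adj G₂ y y′ then (P + s₁) + weight G₂ σ₂ y y′ else 0))
        ≡⟨ cong₂ (λ a b → 2 * (a + b)) (sum-suc (λ x → toℕ (entry x y))) inside ⟩
      2 * ((n₁ + e) + (r₂ * (P + s₁) + fplus G₂ σ₂ y))     ≡⟨ regroup (r₂ * (P + s₁)) (fplus G₂ σ₂ y) n₁ e ⟩
      2 * fplus G₂ σ₂ y + (2 * (r₂ * (P + s₁)) + ((n₁ + 2 * e) + n₁))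
        ≡⟨ cong (λ z → 2 * fplus G₂ σ₂ y + (2 * (r₂ * (P + s₁)) + (z + n₁))) (col-sum y) ⟩
      2 * fplus G₂ σ₂ y + (2 * (r₂ * (P + s₁)) + (n₁ * P + n₁))
        ≡⟨ cong (λ z → 2 * fplus G₂ σ₂ y + (2 * (r₂ * (P + s₁)) + z)) (factor n₁ P) ⟩
      2 * fplus G₂ σ₂ y + shift₂                           ∎
      where
      open ≡-Reasoning
      e = Σℕ.sum (λ x → toℕ (entry x y))
      inside : Σℕ.sum (λ y′ → if adj G₂ y y′ then (P + s₁) + weight G₂ σ₂ y y′ else 0) ≡ r₂ * (P + s₁) + fplus G₂ σ₂ y
      inside = trans (sum-if-+ (P + s₁) (adj G₂ y) (weight G₂ σ₂ y))
        (cong₂ (λ d f → d * (P + s₁) + f) (trans (sym (sum-allFin (λ v → if adj G₂ y v then 1 else 0))) (regular₂ y))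
          (sym (fplus-weight G₂ σ₂ (weight G₂ σ₂) (weight-sym G₂ σ₂) (weight-edge G₂ σ₂) y)))
      regroup : ∀ a f n e → 2 * ((n + e) + (a + f)) ≡ 2 * f + (2 * a + ((n + 2 * e) + n))
      regroup = ℕR.solve-∀
      factor : ∀ n P → n * P + n ≡ n * (P + 1)
      factor = ℕR.solve-∀

    twice-fplus : ∀ u → 2 * fplus G σ u ≡ twice-vertexSum (splitAt n₁ u)
    twice-fplus u = trans (cong (2 *_) (fplus-join u)) (vertexSum-value (splitAt n₁ u))

    -- Turns the raise by `s₁` into degrees; this is where the term p₁r₁r₂/2 of the excluded
    -- difference comes from.
    twice-size : 2 * s₁ ≡ n₁ * r₁
    twice-size = trans (handshake G₁) (trans (Σℕ.sum-cong-≗ regular₁) (sum-const n₁ r₁))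

-- Bounds on the number of colors

colors : (G : Graph) → Labeling G → List ℕ
colors G σ = deduplicate ℕ._≟_ (map (fplus G σ) (allFin (Graph.n G)))

∈-values⁺ : ∀ {n} (f : Fin n → ℕ) u → f u ∈ deduplicate ℕ._≟_ (map f (allFin n))
∈-values⁺ f u = ∈P.∈-deduplicate⁺ ℕ._≟_ (∈P.∈-map⁺ f (∈P.∈-allFin u))

∈-values⁻ : ∀ {n} (f : Fin n → ℕ) {z} → z ∈ deduplicate ℕ._≟_ (map f (allFin n)) → ∃ λ u → z ≡ f u
∈-values⁻ {n} f z∈ = let u , _ , eq = ∈P.∈-map⁻ f (∈P.∈-deduplicate⁻ ℕ._≟_ (map f (allFin n)) z∈) in u , eq

-- The position of a vertex's value in the list of distinct values is itself a proper coloring.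
chromatic⇒values≥ : ∀ G {t} → IsChromaticNumber G t → (f : Fin (Graph.n G) → ℕ) →
  (∀ u v → T (adj G u v) → f u ≢ f v) → t ≤ length (deduplicate ℕ._≟_ (map f (allFin (Graph.n G))))
chromatic⇒values≥ G (_ , minimal) f proper = ℕP.≮⇒≥ λ lt → minimal _ lt (color , color-proper)
  where
  values = deduplicate ℕ._≟_ (map f (allFin (Graph.n G)))
  color : Fin (Graph.n G) → Fin (length values)
  color u = Any.index (∈-values⁺ f u)
  color-proper : ProperColoring G (length values) color
  color-proper u v a eq = proper u v a
    (trans (AnyP.lookup-index (∈-values⁺ f u)) (trans (cong (lookup values) eq) (sym (AnyP.lookup-index (∈-values⁺ f v)))))

joinAdj-↑ˡ : ∀ G₁ G₂ {x x′} → T (adj G₁ x x′) → T (adj (join G₁ G₂) (x ↑ˡ Graph.n G₂) (x′ ↑ˡ Graph.n G₂))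
joinAdj-↑ˡ G₁ G₂ {x} {x′} a
  rewrite FP.splitAt-↑ˡ (Graph.n G₁) x (Graph.n G₂) | FP.splitAt-↑ˡ (Graph.n G₁) x′ (Graph.n G₂) = a

joinAdj-↑ʳ : ∀ G₁ G₂ {y y′} → T (adj G₂ y y′) → T (adj (join G₁ G₂) (Graph.n G₁ ↑ʳ y) (Graph.n G₁ ↑ʳ y′))
joinAdj-↑ʳ G₁ G₂ {y} {y′} a
  rewrite FP.splitAt-↑ʳ (Graph.n G₁) (Graph.n G₂) y | FP.splitAt-↑ʳ (Graph.n G₁) (Graph.n G₂) y′ = a

joinAdj-cross : ∀ G₁ G₂ x y → T (adj (join G₁ G₂) (x ↑ˡ Graph.n G₂) (Graph.n G₁ ↑ʳ y))
joinAdj-cross G₁ G₂ x y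
  rewrite FP.splitAt-↑ˡ (Graph.n G₁) x (Graph.n G₂) | FP.splitAt-↑ʳ (Graph.n G₁) (Graph.n G₂) y = _

-- The sums of the join restricted to one side need not come from any labeling of that side; they
-- are merely proper colorings, so it is the chromatic number that bounds them.
chiLa-join-≥ : ∀ G₁ G₂ {t₁ t₂} → IsChromaticNumber G₁ t₁ → IsChromaticNumber G₂ t₂ → ChiLaAtLeast (join G₁ G₂) (t₁ + t₂)
chiLa-join-≥ G₁ G₂ {t₁} {t₂} χ₁ χ₂ σ antimagic = begin
  t₁ + t₂                        ≤⟨ ℕP.+-mono-≤ (chromatic⇒values≥ G₁ χ₁ f₁ (λ u v a → antimagic _ _ (joinAdj-↑ˡ G₁ G₂ a)))
                                                (chromatic⇒values≥ G₂ χ₂ f₂ (λ u v a → antimagic _ _ (joinAdj-↑ʳ G₁ G₂ a))) ⟩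
  length C₁ + length C₂          ≡⟨ ListP.length-++ C₁ ⟨
  length (C₁ List.++ C₂)         ≤⟨ unique-⊆⇒length≤ (UniqueP.++⁺ (DecUnique.deduplicate-! ℕ._≟_ _) (DecUnique.deduplicate-! ℕ._≟_ _) disjoint) included ⟩
  numColors (join G₁ G₂) σ       ∎
  where
  open ℕP.≤-Reasoning
  f = fplus (join G₁ G₂) σ
  f₁ : Fin (Graph.n G₁) → ℕ
  f₁ x = f (x ↑ˡ Graph.n G₂)
  f₂ : Fin (Graph.n G₂) → ℕ
  f₂ y = f (Graph.n G₁ ↑ʳ y)
  C₁ = deduplicate ℕ._≟_ (map f₁ (allFin (Graph.n G₁)))
  C₂ = deduplicate ℕ._≟_ (map f₂ (allFin (Graph.n G₂)))
  disjoint : ∀ {z} → ¬ (z ∈ C₁ × z ∈ C₂)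
  disjoint (z∈₁ , z∈₂) =
    let x , eq₁ = ∈-values⁻ f₁ z∈₁
        y , eq₂ = ∈-values⁻ f₂ z∈₂
    in antimagic _ _ (joinAdj-cross G₁ G₂ x y) (trans (sym eq₁) eq₂)
  included : ∀ {z} → z ∈ C₁ List.++ C₂ → z ∈ colors (join G₁ G₂) σ
  included z∈ with ∈P.∈-++⁻ C₁ z∈
  ... | inj₁ z∈₁ = let x , eq = ∈-values⁻ f₁ z∈₁ in subst (_∈ _) (sym eq) (∈-values⁺ f (x ↑ˡ Graph.n G₂))
  ... | inj₂ z∈₂ = let y , eq = ∈-values⁻ f₂ z∈₂ in subst (_∈ _) (sym eq) (∈-values⁺ f (Graph.n G₁ ↑ʳ y))

-- Turns tᵢ ≥ 3 into sides of length at least 3 for the magic rectangle.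
numColors≤order : ∀ G σ → numColors G σ ≤ Graph.n G
numColors≤order G σ = ℕP.≤-trans (ListP.length-deduplicate ℕ._≟_ (map (fplus G σ) (allFin (Graph.n G))))
  (ℕP.≤-reflexive (trans (ListP.length-map (fplus G σ) (allFin (Graph.n G))) (ListP.length-tabulate id)))

halve-twice : ∀ n → ⌊ 2 * n /2⌋ ≡ n
halve-twice n = trans (cong (λ m → ⌊ n + m /2⌋) (ℕP.+-identityʳ n)) (sym (ℕP.n≡⌊n+n/2⌋ n))

-- The excluded equation is multiplied by 2 to stay within the integers.
ForbiddenDifference : ∀ (G₁ G₂ : Graph) → Labeling G₁ → Labeling G₂ → ℕ → ℕ → Set
ForbiddenDifference G₁ G₂ σ₁ σ₂ r₁ r₂ = ∀ u v →
  (+ 2) *ℤ ((+ fplus G₂ σ₂ v) -ℤ (+ fplus G₁ σ₁ u))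
    ≢ ((+ order G₂) -ℤ (+ order G₁)) *ℤ (+ (order G₁ * order G₂ + 1))
      +ℤ (+ 2) *ℤ ((+ r₁) -ℤ (+ r₂)) *ℤ (+ (order G₁ * order G₂))
      -ℤ (+ (order G₁ * r₁ * r₂))

chiLa-join-≤ : ∀ G₁ G₂ {r₁ r₂ t₁ t₂} → Regular G₁ r₁ → Regular G₂ r₂ →
  (σ₁ : Labeling G₁) → IsLocalAntimagicColoring G₁ σ₁ t₁ → (σ₂ : Labeling G₂) → IsLocalAntimagicColoring G₂ σ₂ t₂ →
  ForbiddenDifference G₁ G₂ σ₁ σ₂ r₁ r₂ → MagicRectangle (order G₁) (order G₂) → ChiLaAtMost (join G₁ G₂) (t₁ + t₂)
chiLa-join-≤ G₁ G₂ {r₁} {r₂} {t₁} {t₂} regular₁ regular₂ σ₁ (antimagic₁ , count₁) σ₂ (antimagic₂ , count₂) forbidden R =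
  σ , antimagic , few
  where
  open JoinLabeling G₁ G₂ σ₁ σ₂ R
  c₁ = shift₁ regular₁ regular₂
  c₂ = shift₂ regular₁ regular₂
  twice = twice-vertexSum regular₁ regular₂

  -- A coincidence would force 2(b - a) = c₁ - c₂, and with 2s₁ = n₁r₁ the right side is the
  -- excluded value.
  cross : ∀ x y → 2 * fplus G₁ σ₁ x + c₁ ≢ 2 * fplus G₂ σ₂ y + c₂
  cross x y eq = forbidden x y (begin
    + 2 *ℤ (+ b -ℤ + a)                              ≡⟨ isolate (+ a) (+ b) (+ c₁) (+ c₂) ⟩
    ((+ 2 *ℤ + b +ℤ + c₂) -ℤ (+ 2 *ℤ + a +ℤ + c₁)) +ℤ (+ c₁ -ℤ + c₂)
      ≡⟨ cong₂ (λ u v → (u -ℤ v) +ℤ (+ c₁ -ℤ + c₂)) (cast₂ b c₂) (cast₂ a c₁) ⟨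
    (+ (2 * b + c₂) -ℤ + (2 * a + c₁)) +ℤ (+ c₁ -ℤ + c₂)
      ≡⟨ cong (λ u → (u -ℤ + (2 * a + c₁)) +ℤ (+ c₁ -ℤ + c₂)) (cong +_ (sym eq)) ⟩
    (+ (2 * a + c₁) -ℤ + (2 * a + c₁)) +ℤ (+ c₁ -ℤ + c₂) ≡⟨ cancel (+ (2 * a + c₁)) (+ c₁ -ℤ + c₂) ⟩
    + c₁ -ℤ + c₂                                     ≡⟨ cong₂ _-ℤ_ c₁-value c₂-value ⟩
    (+ 2 *ℤ (+ r₁ *ℤ + P) +ℤ + n₂ *ℤ (+ P +ℤ + 1))
      -ℤ (+ 2 *ℤ (+ r₂ *ℤ + P) +ℤ + r₂ *ℤ (+ n₁ *ℤ + r₁) +ℤ + n₁ *ℤ (+ P +ℤ + 1))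
      ≡⟨ collect (+ r₁) (+ r₂) (+ n₁) (+ n₂) (+ P) ⟩
    (+ n₂ -ℤ + n₁) *ℤ (+ P +ℤ + 1) +ℤ + 2 *ℤ (+ r₁ -ℤ + r₂) *ℤ + P -ℤ + n₁ *ℤ + r₁ *ℤ + r₂
      ≡⟨ cong (λ w → (+ n₂ -ℤ + n₁) *ℤ (+ P +ℤ + 1) +ℤ + 2 *ℤ (+ r₁ -ℤ + r₂) *ℤ + P -ℤ w) cube ⟨
    (+ n₂ -ℤ + n₁) *ℤ + (P + 1) +ℤ + 2 *ℤ (+ r₁ -ℤ + r₂) *ℤ + P -ℤ + (n₁ * r₁ * r₂) ∎)
    where
    open ≡-Reasoning
    a = fplus G₁ σ₁ x
    b = fplus G₂ σ₂ y
    cast₂ : ∀ m c → + (2 * m + c) ≡ + 2 *ℤ + m +ℤ + c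
    cast₂ m c = cong (_+ℤ + c) (ℤP.pos-* 2 m)
    isolate : ∀ a b c d → + 2 *ℤ (b -ℤ a) ≡ ((+ 2 *ℤ b +ℤ d) -ℤ (+ 2 *ℤ a +ℤ c)) +ℤ (c -ℤ d)
    isolate = ℤR.solve-∀
    cancel : ∀ u v → (u -ℤ u) +ℤ v ≡ v
    cancel = ℤR.solve-∀
    c₁-value : + c₁ ≡ + 2 *ℤ (+ r₁ *ℤ + P) +ℤ + n₂ *ℤ (+ P +ℤ + 1)
    c₁-value = cong₂ _+ℤ_ (trans (ℤP.pos-* 2 (r₁ * P)) (cong (+ 2 *ℤ_) (ℤP.pos-* r₁ P))) (ℤP.pos-* n₂ (P + 1))
    c₂-ℕ : c₂ ≡ 2 * (r₂ * P) + r₂ * (n₁ * r₁) + n₁ * (P + 1)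
    c₂-ℕ = trans (distribute r₂ P s₁ (n₁ * (P + 1)))
                 (cong (λ w → 2 * (r₂ * P) + r₂ * w + n₁ * (P + 1)) (twice-size regular₁ regular₂))
      where
      distribute : ∀ r P s w → 2 * (r * (P + s)) + w ≡ 2 * (r * P) + r * (2 * s) + w
      distribute = ℕR.solve-∀
    c₂-value : + c₂ ≡ + 2 *ℤ (+ r₂ *ℤ + P) +ℤ + r₂ *ℤ (+ n₁ *ℤ + r₁) +ℤ + n₁ *ℤ (+ P +ℤ + 1)
    c₂-value = trans (cong +_ c₂-ℕ)
      (cong₂ _+ℤ_ (cong₂ _+ℤ_ (trans (ℤP.pos-* 2 (r₂ * P)) (cong (+ 2 *ℤ_) (ℤP.pos-* r₂ P)))
                              (trans (ℤP.pos-* r₂ (n₁ * r₁)) (cong (+ r₂ *ℤ_) (ℤP.pos-* n₁ r₁))))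
                  (ℤP.pos-* n₁ (P + 1)))
    collect : ∀ r s m n P → (+ 2 *ℤ (r *ℤ P) +ℤ n *ℤ (P +ℤ + 1)) -ℤ (+ 2 *ℤ (s *ℤ P) +ℤ s *ℤ (m *ℤ r) +ℤ m *ℤ (P +ℤ + 1))
                              ≡ (n -ℤ m) *ℤ (P +ℤ + 1) +ℤ + 2 *ℤ (r -ℤ s) *ℤ P -ℤ m *ℤ r *ℤ s
    collect = ℤR.solve-∀
    cube : + (n₁ * r₁ * r₂) ≡ + n₁ *ℤ + r₁ *ℤ + r₂
    cube = trans (ℤP.pos-* (n₁ * r₁) r₂) (cong (_*ℤ + r₂) (ℤP.pos-* n₁ r₁))

  separated : ∀ s t → T (joinAdj′ (adj G₁) (adj G₂) s t) → twice s ≢ twice t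
  separated (inj₁ x) (inj₁ x′) a eq = antimagic₁ x x′ a (ℕP.*-cancelˡ-≡ _ _ 2 (ℕP.+-cancelʳ-≡ c₁ _ _ eq))
  separated (inj₁ x) (inj₂ y)  _ eq = cross x y eq
  separated (inj₂ y) (inj₁ x)  _ eq = cross x y (sym eq)
  separated (inj₂ y) (inj₂ y′) a eq = antimagic₂ y y′ a (ℕP.*-cancelˡ-≡ _ _ 2 (ℕP.+-cancelʳ-≡ c₂ _ _ eq))

  antimagic : IsLocalAntimagic G σ
  antimagic u v a eq = separated (splitAt n₁ u) (splitAt n₁ v) a
    (trans (sym (twice-fplus regular₁ regular₂ u)) (trans (cong (2 *_) eq) (twice-fplus regular₁ regular₂ v)))

  -- For a color z of either graph the halved number is twice a vertex sum of the join, so nothing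
  -- is rounded.
  recolor₁ recolor₂ : ℕ → ℕ
  recolor₁ z = ⌊ 2 * z + c₁ /2⌋
  recolor₂ z = ⌊ 2 * z + c₂ /2⌋
  palette = map recolor₁ (colors G₁ σ₁) List.++ map recolor₂ (colors G₂ σ₂)

  in-palette : ∀ s → ⌊ twice s /2⌋ ∈ palette
  in-palette (inj₁ x) = ∈P.∈-++⁺ˡ (∈P.∈-map⁺ recolor₁ (∈-values⁺ (fplus G₁ σ₁) x))
  in-palette (inj₂ y) = ∈P.∈-++⁺ʳ (map recolor₁ (colors G₁ σ₁)) (∈P.∈-map⁺ recolor₂ (∈-values⁺ (fplus G₂ σ₂) y))

  included : ∀ {z} → z ∈ colors G σ → z ∈ palette
  included z∈ = let u , eq = ∈-values⁻ (fplus G σ) z∈ in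
    subst (_∈ palette) (trans (cong ⌊_/2⌋ (sym (twice-fplus regular₁ regular₂ u))) (trans (halve-twice (fplus G σ u)) (sym eq)))
      (in-palette (splitAt n₁ u))

  few : numColors G σ ≤ t₁ + t₂
  few = ℕP.≤-trans (unique-⊆⇒length≤ (DecUnique.deduplicate-! ℕ._≟_ _) included)
    (ℕP.≤-reflexive (trans (ListP.length-++ (map recolor₁ (colors G₁ σ₁)))
      (cong₂ _+_ (trans (ListP.length-map recolor₁ (colors G₁ σ₁)) count₁) (trans (ListP.length-map recolor₂ (colors G₂ σ₂)) count₂))))

theorem3p15 : (r₁ r₂ t₁ t₂ p₁ p₂ r : ℕ) → 2 ≤ r₁ → 2 ≤ r₂ → 3 ≤ t₁ → 3 ≤ t₂ →
    (G₁ G₂ : Graph) →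
    order G₁ ≡ p₁ → order G₂ ≡ p₂ → Regular G₁ r₁ → Regular G₂ r₂ →
    (f₁ : Labeling G₁) → IsLocalAntimagicColoring G₁ f₁ t₁ →
    (f₂ : Labeling G₂) → IsLocalAntimagicColoring G₂ f₂ t₂ →
    r₁ + p₂ ≡ r → r₂ + p₁ ≡ r →
    p₁ % 2 ≡ p₂ % 2 →
    (∀ u v →
    (+ 2) *ℤ ((+ fplus G₂ f₂ v) -ℤ (+ fplus G₁ f₁ u))
    ≢ ((+ p₂) -ℤ (+ p₁)) *ℤ (+ (p₁ * p₂ + 1))
    +ℤ (+ 2) *ℤ ((+ r₁) -ℤ (+ r₂)) *ℤ (+ (p₁ * p₂))
    -ℤ (+ (p₁ * r₁ * r₂))) →
    ChiLaAtMost (join G₁ G₂) (t₁ + t₂)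
    × (IsChromaticNumber G₁ t₁ → IsChromaticNumber G₂ t₂ →
    ChiLaEq (join G₁ G₂) (t₁ + t₂))
theorem3p15 r₁ r₂ t₁ t₂ _ _ r _ _ 3≤t₁ 3≤t₂ G₁ G₂ refl refl regular₁ regular₂ f₁ coloring₁ f₂ coloring₂ _ _ parity forbidden =
  upper , λ χ₁ χ₂ → upper , chiLa-join-≥ G₁ G₂ χ₁ χ₂
  where
  order≥3 : ∀ G σ {t} → 3 ≤ t → IsLocalAntimagicColoring G σ t → 3 ≤ order G
  order≥3 G σ 3≤t (_ , refl) = ℕP.≤-trans 3≤t (numColors≤order G σ)
  upper : ChiLaAtMost (join G₁ G₂) (t₁ + t₂)
  upper = chiLa-join-≤ G₁ G₂ regular₁ regular₂ f₁ coloring₁ f₂ coloring₂ forbidden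
    (magicRectangle (order G₁) (order G₂) (order≥3 G₁ f₁ 3≤t₁ coloring₁) (order≥3 G₂ f₂ 3≤t₂ coloring₂) parity)
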